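{- There is a deterministic algorithm $\mathcal{A}_{\mathrm{Online}}$ with the following guarantee. Given as input a randomized $q$-query algorithm $R:\{0,1\}^n\times\{0,1\}^m\to[0,1]$ with description length $N$, an error parameter $\varepsilon\in(0,\frac12)$, and an input $\underline{x}\in\{0,1\}^n$, the algorithm $\mathcal{A}_{\mathrm{Online}}$ runs in time $\mathrm{poly}(N,q,1/\varepsilon)$, makes $O(q^2/\varepsilon^3)$ queries to $\underline{x}$, and returns a value $\mathcal{A}_{\mathrm{Online}}(\underline{x})\in[0,1]$. The output values of $\mathcal{A}_{\mathrm{Online}}$ (for fixed $R$ and $\varepsilon$, as a function of the input) satisfy $$\mathop{\mathbb{E}}_{x}\Big[\big(\mathcal{A}_{\mathrm{Online}}(x)-\mathop{\mathbb{E}}_{r}[R(x,r)]\big)^2\Big]\le\varepsilon,$$ where $x\sim\{0,1\}^n$ and $r\sim\{0,1\}^m$ are uniformly random.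
   Context: Query algorithms are represented as binary decision trees. An $n$-variable randomized decision tree (RDT) is a binary tree with two types of internal nodes: decision nodes, which branch on the value of one of the boolean variables $x_1,\dots,x_n$, and stochastic nodes, which branch on the outcome of an independent $\mathrm{Bernoulli}(\frac12)$ random bit. Leaves are labelled by values in $[0,1]$. Its query complexity is the maximum number of decision nodes on any root-to-leaf path, and its randomness complexity is the maximum number $m$ of stochastic nodes on any root-to-leaf path. The RDT computes a function $R:\{0,1\}^n\times\{0,1\}^m\to[0,1]$, where $R(x,r)$ is the label of the leaf reached on input $x$ when the stochastic nodes encountered branch according to the bits of $r$. A randomized $q$-query algorithm is an RDT of query complexity at most $q$. The description length is the length of the description of the tree. A query to $\underline{x}$ means reading one coordinate of $\underline{x}$.
   Formalization: The leaf labels of the randomized q-query algorithm R (its values in [0,1]) and the error parameter ε are taken to be rational numbers, given to the algorithm as explicit fractions. -}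

module Defs where

open import Data.Bool.Base using (Bool; true; false; if_then_else_)
open import Data.Fin.Base using (Fin; toℕ) renaming (zero to fzero)
open import Data.Fin.Properties using (toℕ-injective)
open import Data.Integer.Base using (+_; ∣_∣)
open import Data.Nat.Base using (ℕ; zero; suc; _+_; _∸_; _⊔_; _≤_; s≤s; ⌊_/2⌋; NonZero)
open import Data.Nat.Logarithm using (⌊log₂_⌋)
open import Data.Nat.Properties using (m⊔n≤o⇒m≤o; m⊔n≤o⇒n≤o)
open import Data.Product.Base using (_×_; _,_)
open import Data.Rational.Base as ℚ using (ℚ; 0ℚ; 1ℚ; ½; _/_)
open import Data.Rational.Base using (↥_; ↧ₙ_; +-*-rawSemiring)
open import Data.Vec.Base using (Vec; []; _∷_; lookup)
open import Relation.Binary.PropositionalEquality using (_≡_; refl)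

open import Algebra.Definitions.RawSemiring +-*-rawSemiring public using (_^_)

fromℕ : ℕ → ℚ
fromℕ k = + k / 1

------------------------------------------------------------------------
-- Randomized decision trees

-- At an internal node the first subtree is taken when the bit read is 0
-- (false) and the second when it is 1 (true).  Labels are rational, so
-- that a tree has a finite description.

data RDT (n : ℕ) : Set where
  leaf       : (v : ℚ) → 0ℚ ℚ.≤ v → v ℚ.≤ 1ℚ → RDT n
  decision   : Fin n → RDT n → RDT n → RDT n
  stochastic : RDT n → RDT n → RDT n

queryComplexity : ∀ {n} → RDT n → ℕ
queryComplexity (leaf _ _ _)     = 0
queryComplexity (decision _ l r) = suc (queryComplexity l ⊔ queryComplexity r)
queryComplexity (stochastic l r) = queryComplexity l ⊔ queryComplexity r

randomness : ∀ {n} → RDT n → ℕ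
randomness (leaf _ _ _)     = 0
randomness (decision _ l r) = randomness l ⊔ randomness r
randomness (stochastic l r) = suc (randomness l ⊔ randomness r)

-- The j-th stochastic node met on a path branches on the j-th bit of the
-- random string.

run : ∀ {n m} (R : RDT n) → randomness R ≤ m → Vec Bool n → Vec Bool m → ℚ
run (leaf v _ _)     _ x bs = v
run (decision i l r) h x bs =
  if lookup x i then run r (m⊔n≤o⇒n≤o (randomness l) _ h) x bs
                else run l (m⊔n≤o⇒m≤o _ (randomness r) h) x bs
run (stochastic l r) (s≤s h) x (b ∷ bs) =
  if b then run r (m⊔n≤o⇒n≤o (randomness l) _ h) x bs
       else run l (m⊔n≤o⇒m≤o _ (randomness r) h) x bs

------------------------------------------------------------------------
-- Expectation over a uniformly random element of {0,1}ⁿ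

sumCube : ∀ n → (Vec Bool n → ℚ) → ℚ
sumCube zero    f = f []
sumCube (suc n) f = sumCube n (λ x → f (false ∷ x)) ℚ.+ sumCube n (λ x → f (true ∷ x))

𝔼 : ∀ {n} → (Vec Bool n → ℚ) → ℚ
𝔼 {n} f = ½ ^ n ℚ.* sumCube n f

------------------------------------------------------------------------
-- Deterministic query algorithms

-- An algorithm is a program in a first-order language with recursive
-- functions.  Data are binary trees with natural numbers at the leaves, and
-- the input string is accessible only through the instruction `query`.
-- Every evaluation step costs one time unit.  There is deliberately no
-- multiplication: a single step lengthens the binary representation of the
-- largest number present by at most one bit (or produces a constant of the
-- program), and pairs are shared rather than copied, so this time measure is
-- polynomially equivalent to Turing machine time.

data Value : Set where
  nat  : ℕ → Value
  pair : Value → Value → Value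

-- Number of nodes plus number of binary digits of the numbers at the leaves.

size : Value → ℕ
size (nat k)    = 1 + suc ⌊log₂ k ⌋
size (pair v w) = 1 + (size v + size w)

-- p function symbols, n local variables (de Bruijn indices).

data Expr (p n : ℕ) : Set where
  var                : Fin n → Expr p n
  lit                : ℕ → Expr p n
  add monus          : Expr p n → Expr p n → Expr p n
  half               : Expr p n → Expr p n
  cons               : Expr p n → Expr p n → Expr p n
  fst snd            : Expr p n → Expr p n
  ifzero_then_else_  : Expr p n → Expr p n → Expr p n → Expr p n
  let′               : Expr p n → Expr p (suc n) → Expr p n
  call               : Fin p → Expr p n → Expr p n
  query              : Expr p n → Expr p n

-- Each function has one argument; function 0 is the entry point.

record Program : Set where
  field
    extra : ℕ
    body  : Vec (Expr (suc extra) 1) (suc extra)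

bit : Bool → ℕ
bit b = if b then 1 else 0

module Semantics {p N : ℕ} (fs : Vec (Expr p 1) p) (x : Vec Bool N) where

  infix 4 _⊢_⇓_[_,_]

  -- ρ ⊢ e ⇓ v [ t , k ]: in environment ρ, the expression e evaluates to v
  -- in time t, with k queries to x (repeated queries are counted each time).

  data _⊢_⇓_[_,_] {n : ℕ} (ρ : Vec Value n) :
                  Expr p n → Value → ℕ → ℕ → Set where

    ⇓var : ∀ {i} → ρ ⊢ var i ⇓ lookup ρ i [ 1 , 0 ]

    ⇓lit : ∀ {a} → ρ ⊢ lit a ⇓ nat a [ 1 , 0 ]

    ⇓add : ∀ {e e′ a a′ t t′ k k′} →
           ρ ⊢ e  ⇓ nat a  [ t  , k  ] →
           ρ ⊢ e′ ⇓ nat a′ [ t′ , k′ ] →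
           ρ ⊢ add e e′ ⇓ nat (a + a′) [ suc (t + t′) , k + k′ ]

    ⇓monus : ∀ {e e′ a a′ t t′ k k′} →
             ρ ⊢ e  ⇓ nat a  [ t  , k  ] →
             ρ ⊢ e′ ⇓ nat a′ [ t′ , k′ ] →
             ρ ⊢ monus e e′ ⇓ nat (a ∸ a′) [ suc (t + t′) , k + k′ ]

    ⇓half : ∀ {e a t k} →
            ρ ⊢ e ⇓ nat a [ t , k ] →
            ρ ⊢ half e ⇓ nat ⌊ a /2⌋ [ suc t , k ]

    ⇓cons : ∀ {e e′ v v′ t t′ k k′} →
            ρ ⊢ e  ⇓ v  [ t  , k  ] →
            ρ ⊢ e′ ⇓ v′ [ t′ , k′ ] →
            ρ ⊢ cons e e′ ⇓ pair v v′ [ suc (t + t′) , k + k′ ]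

    ⇓fst : ∀ {e v v′ t k} →
           ρ ⊢ e ⇓ pair v v′ [ t , k ] →
           ρ ⊢ fst e ⇓ v [ suc t , k ]

    ⇓snd : ∀ {e v v′ t k} →
           ρ ⊢ e ⇓ pair v v′ [ t , k ] →
           ρ ⊢ snd e ⇓ v′ [ suc t , k ]

    ⇓then : ∀ {e e₁ e₂ v t t′ k k′} →
            ρ ⊢ e  ⇓ nat 0 [ t  , k  ] →
            ρ ⊢ e₁ ⇓ v     [ t′ , k′ ] →
            ρ ⊢ ifzero e then e₁ else e₂ ⇓ v [ suc (t + t′) , k + k′ ]

    ⇓else : ∀ {e e₁ e₂ a v t t′ k k′} →
            ρ ⊢ e  ⇓ nat (suc a) [ t  , k  ] →
            ρ ⊢ e₂ ⇓ v           [ t′ , k′ ] →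
            ρ ⊢ ifzero e then e₁ else e₂ ⇓ v [ suc (t + t′) , k + k′ ]

    ⇓let : ∀ {e e′ v v′ t t′ k k′} →
           ρ       ⊢ e  ⇓ v  [ t  , k  ] →
           (v ∷ ρ) ⊢ e′ ⇓ v′ [ t′ , k′ ] →
           ρ ⊢ let′ e e′ ⇓ v′ [ suc (t + t′) , k + k′ ]

    ⇓call : ∀ {f e v v′ t t′ k k′} →
            ρ        ⊢ e           ⇓ v  [ t  , k  ] →
            (v ∷ []) ⊢ lookup fs f ⇓ v′ [ t′ , k′ ] →
            ρ ⊢ call f e ⇓ v′ [ suc (t + t′) , k + k′ ]

    ⇓query : ∀ {e} {i : Fin N} {t k} →
             ρ ⊢ e ⇓ nat (toℕ i) [ t , k ] →
             ρ ⊢ query e ⇓ nat (bit (lookup x i)) [ suc t , suc k ]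

  private
    nat-injective : ∀ {a b} → nat a ≡ nat b → a ≡ b
    nat-injective refl = refl

  ⇓-deterministic : ∀ {n} {ρ : Vec Value n} {e v v′ t t′ k k′} →
                    ρ ⊢ e ⇓ v [ t , k ] → ρ ⊢ e ⇓ v′ [ t′ , k′ ] →
                    v ≡ v′ × t ≡ t′ × k ≡ k′
  ⇓-deterministic ⇓var ⇓var = refl , refl , refl
  ⇓-deterministic ⇓lit ⇓lit = refl , refl , refl
  ⇓-deterministic (⇓add d e) (⇓add d′ e′)
    with refl , refl , refl ← ⇓-deterministic d d′
       | refl , refl , refl ← ⇓-deterministic e e′ = refl , refl , refl
  ⇓-deterministic (⇓monus d e) (⇓monus d′ e′)
    with refl , refl , refl ← ⇓-deterministic d d′
       | refl , refl , refl ← ⇓-deterministic e e′ = refl , refl , refl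
  ⇓-deterministic (⇓half d) (⇓half d′)
    with refl , refl , refl ← ⇓-deterministic d d′ = refl , refl , refl
  ⇓-deterministic (⇓cons d e) (⇓cons d′ e′)
    with refl , refl , refl ← ⇓-deterministic d d′
       | refl , refl , refl ← ⇓-deterministic e e′ = refl , refl , refl
  ⇓-deterministic (⇓fst d) (⇓fst d′)
    with refl , refl , refl ← ⇓-deterministic d d′ = refl , refl , refl
  ⇓-deterministic (⇓snd d) (⇓snd d′)
    with refl , refl , refl ← ⇓-deterministic d d′ = refl , refl , refl
  ⇓-deterministic (⇓then d e) (⇓then d′ e′)
    with refl , refl , refl ← ⇓-deterministic d d′
       | refl , refl , refl ← ⇓-deterministic e e′ = refl , refl , refl
  ⇓-deterministic (⇓then d e) (⇓else d′ e′)
    with () , _ ← ⇓-deterministic d d′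
  ⇓-deterministic (⇓else d e) (⇓then d′ e′)
    with () , _ ← ⇓-deterministic d d′
  ⇓-deterministic (⇓else d e) (⇓else d′ e′)
    with refl , refl , refl ← ⇓-deterministic d d′
       | refl , refl , refl ← ⇓-deterministic e e′ = refl , refl , refl
  ⇓-deterministic (⇓let d e) (⇓let d′ e′)
    with refl , refl , refl ← ⇓-deterministic d d′
    with refl , refl , refl ← ⇓-deterministic e e′ = refl , refl , refl
  ⇓-deterministic (⇓call d e) (⇓call d′ e′)
    with refl , refl , refl ← ⇓-deterministic d d′
    with refl , refl , refl ← ⇓-deterministic e e′ = refl , refl , refl
  ⇓-deterministic (⇓query d) (⇓query d′)
    with eq , refl , refl ← ⇓-deterministic d d′
    with refl ← toℕ-injective (nat-injective eq) = refl , refl , refl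

-- On explicit input v, and with query access to x, the program A halts with
-- result w after t steps and k queries.

record _on_,_halts-with_[_,_] (A : Program) {n : ℕ} (v : Value) (x : Vec Bool n)
                             (w : Value) (t k : ℕ) : Set where
  constructor halts
  open Program A
  open Semantics body x
  field
    derivation : (v ∷ []) ⊢ call fzero (var fzero) ⇓ w [ t , k ]

------------------------------------------------------------------------
-- Encodings

-- Only used for nonnegative rationals, hence no sign.

encodeℚ : ℚ → Value
encodeℚ v = pair (nat ∣ ↥ v ∣) (nat (↧ₙ v))

encode : ∀ {n} → RDT n → Value
encode (leaf v _ _)     = pair (nat 0) (encodeℚ v)
encode (decision i l r) = pair (nat 1) (pair (nat (toℕ i)) (pair (encode l) (encode r)))
encode (stochastic l r) = pair (nat 2) (pair (encode l) (encode r))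

descriptionLength : ∀ {n} → RDT n → ℕ
descriptionLength R = size (encode R)

-- Outputs are fractions that need not be in lowest terms.

data _Represents_ : Value → ℚ → Set where
  fraction : ∀ a b .{{_ : NonZero b}} → pair (nat a) (nat b) Represents (+ a / b)

module Submission where

-- The algorithm first removes repeated queries from the tree, so that no path reads a variable
-- twice.  It then works in rounds.  Each round computes, for the current tree R, the probability
-- δ i R that a run of R on random input and random bits queries x_i, queries the variable for
-- which this is greatest, and replaces R by its restriction to the answer.  After D rounds, where
-- D is q q / ε rounded up and q is the query complexity, it returns the mean of the current tree.
--
-- Why the error is small.  Let Δ R be the expected number of queries of R.
--
-- (1) The variance of the function computed by R, averaged over the random bits, is at most the
--     sum of (δ i R) (δ i R) over all i (covariance): fixing the answers on a path of one copy of
--     the tree changes the outcome of an independent copy only if that copy queries a variable on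
--     the path (mean-restricts).  Hence the variance is at most Δ R times the greatest δ i R
--     (variance-≤).
-- (2) Querying x_i saves exactly the queries to x_i: on average over the answer, Δ drops by δ i R
--     (Δ-restrict).
--
-- The greatest δ i R is what (1) needs and what (2) pays for, and Δ never exceeds q.  Since the
-- error never exceeds the variance of the current tree (error-≤variance), induction on the number
-- of rounds gives (D + 1) error ≤ q Δ R ≤ q q (error-≤), and q q ≤ D ε.  So the error is at most
-- ε, with at most D ≤ q q / ε + 1 queries, and none if q = 0.
--
-- The time.  Probabilities are compared as integers, scaled by 2 to the number of internal nodes;
-- the mean is computed as an unreduced fraction.  Multiplication is by repeated doubling, which takes
-- time linear in the length of one factor, and that length is linear in the description length.  A queried variable disappears from the
-- tree, so the number of rounds that change the tree is at most its number of nodes.  The precision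
-- of ε does not matter, because the rounds are counted by subtracting the numerator of ε from
-- q q times its denominator.  Altogether the running time is cubic in the description length.

open import Defs
open import Data.Bool.Base using (Bool; true; false; if_then_else_)
open import Data.Empty using (⊥-elim)
open import Data.Fin.Base using (Fin; toℕ) renaming (zero to fzero; suc to fsuc)
open import Data.Fin.Patterns
open import Data.Fin.Properties as Fin using ()
open import Data.Integer.Base as ℤ using (+_)
import Data.Integer.Properties as ℤ
open import Data.List.Base using (List; []; _∷_; _++_)
open import Data.Maybe.Base using (Maybe; just; nothing)
open import Data.Nat.Base as ℕ using (ℕ; zero; suc; z≤n; s≤s; ⌊_/2⌋)
open import Data.Nat.ListAction using (sum)
open import Data.Nat.ListAction.Properties using (sum-++)
open import Data.Nat.Logarithm using (⌊log₂_⌋; ⌊log₂⌋-mono-≤; ⌊log₂[2^n]⌋≡n)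
open import Data.Nat.Properties as ℕ using (≤-refl; m⊔n≤o⇒m≤o; m⊔n≤o⇒n≤o)
open import Data.Nat.Tactic.RingSolver using (solve-∀)
open import Data.Product.Base using (Σ-syntax; ∃-syntax; _×_; _,_; proj₁; proj₂)
open import Data.Rational.Base using (ℚ; mkℚ; 0ℚ; 1ℚ; ½; _+_; _*_; _-_; -_; _≤_; _<_; *≤*; *<*; 1/_; _/_; ↥_; ↧ₙ_; toℚᵘ; positive; nonNegative; nonPositive)
open import Data.Rational.Properties as ℚ using (pos⇒nonZero)
open import Data.Rational.Solver using (module +-*-Solver)
import Data.Rational.Unnormalised.Base as ℚᵘ
import Data.Rational.Unnormalised.Properties as ℚᵘ
open import Data.Sum.Base using (_⊎_; inj₁; inj₂)
open import Data.Unit.Base using (⊤; tt)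
open import Data.Vec.Base using (Vec; []; _∷_; lookup; _[_]≔_)
import Data.Vec.Properties as Vec
open import Function.Base using (_∘_)
open import Relation.Binary.PropositionalEquality using (_≡_; _≢_; refl; sym; trans; cong; cong₂; subst; subst₂)
open import Relation.Nullary.Decidable using (yes; no; True; toWitness)
open +-*-Solver using (solve; con; _:+_; _:*_; _:-_; _:=_)

------------------------------------------------------------------------
-- Rational arithmetic

0≤+ : ∀ {a b} → 0ℚ ≤ a → 0ℚ ≤ b → 0ℚ ≤ a + b
0≤+ p q = ℚ.+-mono-≤ p q

0≤* : ∀ {a b} → 0ℚ ≤ a → 0ℚ ≤ b → 0ℚ ≤ a * b
0≤* {a} {b} p q =
  ℚ.nonNegative⁻¹ _ {{ℚ.nonNeg*nonNeg⇒nonNeg a {{nonNegative p}} b {{nonNegative q}}}}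

0≤½ : 0ℚ ≤ ½
0≤½ = ℚ.nonNegative⁻¹ ½

0≤1 : 0ℚ ≤ 1ℚ
0≤1 = ℚ.nonNegative⁻¹ 1ℚ

0≤² : ∀ a → 0ℚ ≤ a * a
0≤² a with ℚ.≤-total 0ℚ a
... | inj₁ p = 0≤* p p
... | inj₂ p = ℚ.≤-trans (ℚ.≤-reflexive (sym (ℚ.*-zeroʳ a)))
                         (ℚ.*-monoˡ-≤-nonPos a {{nonPositive p}} p)

-- The difference d is passed explicitly, so that what remains is an identity for the solver.
≤-diff : ∀ {b c} d → 0ℚ ≤ d → c ≡ b + d → b ≤ c
≤-diff {b} d p refl = subst (_≤ b + d) (ℚ.+-identityʳ b) (ℚ.+-monoʳ-≤ b p)

diff-≥0 : ∀ {a b} → a ≤ b → 0ℚ ≤ b - a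
diff-≥0 {a} {b} p = subst (_≤ b - a) (ℚ.+-inverseʳ a) (ℚ.+-monoˡ-≤ (- a) p)

*-monoˡ : ∀ {a b c} → 0ℚ ≤ c → a ≤ b → c * a ≤ c * b
*-monoˡ {c = c} p = ℚ.*-monoˡ-≤-nonNeg c {{nonNegative p}}

mean-mono : ∀ {a b c d} → a ≤ c → b ≤ d → ½ * (a + b) ≤ ½ * (c + d)
mean-mono p q = *-monoˡ 0≤½ (ℚ.+-mono-≤ p q)

≤-+ʳ : ∀ {a b c} → 0ℚ ≤ c → a ≤ b → a ≤ b + c
≤-+ʳ {a} p q = subst (_≤ _) (ℚ.+-identityʳ a) (ℚ.+-mono-≤ q p)

toℚᵘ-/ : ∀ a b .{{_ : ℕ.NonZero b}} → toℚᵘ (+ a / b) ℚᵘ.≃ (+ a ℚᵘ./ b)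
toℚᵘ-/ a (suc b) = ℚ.toℚᵘ-fromℚᵘ (ℚᵘ.mkℚᵘ (+ a) b)

fromℕ-+ : ∀ a b → fromℕ (a ℕ.+ b) ≡ fromℕ a + fromℕ b
fromℕ-+ a b = ℚ.toℚᵘ-injective (ℚᵘ.≃-trans (toℚᵘ-/ (a ℕ.+ b) 1) (ℚᵘ.≃-sym
  (ℚᵘ.≃-trans (ℚ.toℚᵘ-homo-+ (fromℕ a) (fromℕ b))
  (ℚᵘ.≃-trans (ℚᵘ.+-cong (toℚᵘ-/ a 1) (toℚᵘ-/ b 1))
  (ℚᵘ.*≡* (cong (ℤ._* + 1) (cong₂ ℤ._+_ (ℤ.*-identityʳ (+ a)) (ℤ.*-identityʳ (+ b)))))))))

fromℕ-* : ∀ a b → fromℕ (a ℕ.* b) ≡ fromℕ a * fromℕ b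
fromℕ-* a b = ℚ.toℚᵘ-injective (ℚᵘ.≃-trans (toℚᵘ-/ (a ℕ.* b) 1) (ℚᵘ.≃-sym
  (ℚᵘ.≃-trans (ℚ.toℚᵘ-homo-* (fromℕ a) (fromℕ b))
  (ℚᵘ.≃-trans (ℚᵘ.*-cong (toℚᵘ-/ a 1) (toℚᵘ-/ b 1))
  (ℚᵘ.*≡* (cong (ℤ._* + 1) (sym (ℤ.pos-* a b))))))))

fromℕ-mono : ∀ {a b} → a ℕ.≤ b → fromℕ a ≤ fromℕ b
fromℕ-mono {a} {b} p = ℚ.toℚᵘ-cancel-≤
  (ℚᵘ.≤-respˡ-≃ (ℚᵘ.≃-sym (toℚᵘ-/ a 1)) (ℚᵘ.≤-respʳ-≃ (ℚᵘ.≃-sym (toℚᵘ-/ b 1))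
    (ℚᵘ.*≤* (ℤ.*-monoʳ-≤-nonNeg (+ 1) (ℤ.+≤+ p)))))

0≤fromℕ : ∀ a → 0ℚ ≤ fromℕ a
0≤fromℕ a = fromℕ-mono {0} {a} z≤n

-- The fraction a / b is characterised by (a / b) b = a.
/-cancel : ∀ a b .{{_ : ℕ.NonZero b}} → (+ a / b) * fromℕ b ≡ fromℕ a
/-cancel a b@(suc b′) = ℚ.toℚᵘ-injective
  (ℚᵘ.≃-trans (ℚ.toℚᵘ-homo-* (+ a / b) (fromℕ b))
  (ℚᵘ.≃-trans (ℚᵘ.*-cong (toℚᵘ-/ a b) (toℚᵘ-/ b 1))
  (ℚᵘ.≃-trans (ℚᵘ.*≡* (trans (ℤ.*-identityʳ (+ a ℤ.* + b)) (cong (λ z → + a ℤ.* + z) (sym (ℕ.*-identityʳ b)))))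
  (ℚᵘ.≃-sym (toℚᵘ-/ a 1)))))

0<fromℕ : ∀ b .{{_ : ℕ.NonZero b}} → 0ℚ < fromℕ b
0<fromℕ (suc b) = ℚ.<-≤-trans (ℚ.positive⁻¹ 1ℚ) (fromℕ-mono {1} {suc b} (s≤s z≤n))

/-unique : ∀ {r} a b .{{_ : ℕ.NonZero b}} → r * fromℕ b ≡ fromℕ a → r ≡ + a / b
/-unique {r} a b eq = ℚ.≤-antisym
    (cancel (ℚ.≤-reflexive (trans eq (sym (/-cancel a b)))))
    (cancel (ℚ.≤-reflexive (trans (/-cancel a b) (sym eq))))
  where
  cancel : ∀ {x y} → x * fromℕ b ≤ y * fromℕ b → x ≤ y
  cancel = ℚ.*-cancelʳ-≤-pos (fromℕ b) {{positive (0<fromℕ b)}}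

------------------------------------------------------------------------
-- Expectation over the cube

𝔼-suc : ∀ {n} (f : Vec Bool (suc n) → ℚ) →
        𝔼 f ≡ ½ * (𝔼 (f ∘ (false ∷_)) + 𝔼 (f ∘ (true ∷_)))
𝔼-suc {n} f = solve 3 (λ h a b → (con ½ :* h) :* (a :+ b) := con ½ :* (h :* a :+ h :* b)) refl
  (½ ^ n) (sumCube n (f ∘ (false ∷_))) (sumCube n (f ∘ (true ∷_)))

𝔼-[] : (f : Vec Bool 0 → ℚ) → 𝔼 f ≡ f []
𝔼-[] f = ℚ.*-identityˡ (f [])

𝔼-cong : ∀ {n} {f g : Vec Bool n → ℚ} → (∀ x → f x ≡ g x) → 𝔼 f ≡ 𝔼 g
𝔼-cong {zero}  {f} {g} p = cong (1ℚ *_) (p [])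
𝔼-cong {suc n} {f} {g} p = trans (𝔼-suc f) (trans
  (cong₂ (λ a b → ½ * (a + b)) (𝔼-cong (p ∘ (false ∷_))) (𝔼-cong (p ∘ (true ∷_))))
  (sym (𝔼-suc g)))

𝔼-const : ∀ {n} c → 𝔼 {n} (λ _ → c) ≡ c
𝔼-const {zero}  c = 𝔼-[] (λ _ → c)
𝔼-const {suc n} c = trans (𝔼-suc {n} (λ _ → c))
  (trans (cong (λ a → ½ * (a + a)) (𝔼-const {n} c))
         (solve 1 (λ c → con ½ :* (c :+ c) := c) refl c))

𝔼-linear : ∀ {n} a b (f g : Vec Bool n → ℚ) → 𝔼 (λ x → a * f x + b * g x) ≡ a * 𝔼 f + b * 𝔼 g
𝔼-linear {zero} a b f g = solve 4 (λ a b c d →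
    con 1ℚ :* (a :* c :+ b :* d) := a :* (con 1ℚ :* c) :+ b :* (con 1ℚ :* d)) refl a b (f []) (g [])
𝔼-linear {suc n} a b f g = trans (𝔼-suc (λ x → a * f x + b * g x)) (trans
  (cong₂ (λ a b → ½ * (a + b)) (𝔼-linear a b (f ∘ (false ∷_)) (g ∘ (false ∷_)))
                               (𝔼-linear a b (f ∘ (true ∷_)) (g ∘ (true ∷_))))
  (trans (solve 6 (λ a b p q r s →
            con ½ :* (a :* p :+ b :* q :+ (a :* r :+ b :* s)) :=
            a :* (con ½ :* (p :+ r)) :+ b :* (con ½ :* (q :+ s))) refl a b
            (𝔼 (f ∘ (false ∷_))) (𝔼 (g ∘ (false ∷_))) (𝔼 (f ∘ (true ∷_))) (𝔼 (g ∘ (true ∷_))))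
         (cong₂ (λ p q → a * p + b * q) (sym (𝔼-suc f)) (sym (𝔼-suc g)))))

𝔼-scale : ∀ {n} a (f : Vec Bool n → ℚ) → 𝔼 (λ x → a * f x) ≡ a * 𝔼 f
𝔼-scale a f = trans (𝔼-cong (λ x → solve 2 (λ a y → a :* y := a :* y :+ con 0ℚ :* y) refl a (f x)))
  (trans (𝔼-linear a 0ℚ f f) (solve 2 (λ a y → a :* y :+ con 0ℚ :* y := a :* y) refl a (𝔼 f)))

𝔼-average : ∀ {n} (f g : Vec Bool n → ℚ) → 𝔼 (λ x → ½ * (f x + g x)) ≡ ½ * (𝔼 f + 𝔼 g)
𝔼-average f g = trans (𝔼-cong (λ x → ℚ.*-distribˡ-+ ½ (f x) (g x)))
  (trans (𝔼-linear ½ ½ f g) (sym (ℚ.*-distribˡ-+ ½ (𝔼 f) (𝔼 g))))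

-- Conditioning on one coordinate.
𝔼-split : ∀ {n} (i : Fin n) (f : Vec Bool n → ℚ) →
          𝔼 f ≡ ½ * (𝔼 (λ x → f (x [ i ]≔ false)) + 𝔼 (λ x → f (x [ i ]≔ true)))
𝔼-split {suc n} fzero f = trans (𝔼-suc f) (cong₂ (λ a b → ½ * (a + b)) (average false) (average true))
  where
  average : ∀ b → 𝔼 (f ∘ (b ∷_)) ≡ 𝔼 (λ x → f (x [ fzero ]≔ b))
  average b = sym (trans (𝔼-suc (λ x → f (x [ fzero ]≔ b)))
    (solve 1 (λ c → con ½ :* (c :+ c) := c) refl (𝔼 (f ∘ (b ∷_)))))
𝔼-split {suc n} (fsuc i) f = trans (𝔼-suc f) (trans
  (cong₂ (λ a b → ½ * (a + b)) (𝔼-split i (f ∘ (false ∷_))) (𝔼-split i (f ∘ (true ∷_))))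
  (trans (solve 4 (λ p q r s → con ½ :* (con ½ :* (p :+ q) :+ con ½ :* (r :+ s)) :=
                               con ½ :* (con ½ :* (p :+ r) :+ con ½ :* (q :+ s))) refl
            (E false false) (E false true) (E true false) (E true true))
    (cong₂ (λ a b → ½ * (a + b)) (sym (𝔼-suc (λ x → f (x [ fsuc i ]≔ false))))
                                 (sym (𝔼-suc (λ x → f (x [ fsuc i ]≔ true)))))))
  where
  E : Bool → Bool → ℚ
  E a b = 𝔼 (λ x → f (a ∷ (x [ i ]≔ b)))

------------------------------------------------------------------------
-- Values of a tree

-- The expected label of the leaf reached on x, over the random bits.
val : ∀ {n} → RDT n → Vec Bool n → ℚ
val (leaf v _ _)     x = v
val (decision i l r) x = if lookup x i then val r x else val l x
val (stochastic l r) x = ½ * (val l x + val r x)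

𝔼-run : ∀ {n m} (R : RDT n) (h : randomness R ℕ.≤ m) x → 𝔼 (λ r → run R h x r) ≡ val R x
𝔼-run {m = m} (leaf v _ _) h x = 𝔼-const {m} v
𝔼-run {m = m} (decision i l r) h x with lookup x i
... | true  = 𝔼-run {m = m} r (m⊔n≤o⇒n≤o (randomness l) _ h) x
... | false = 𝔼-run {m = m} l (m⊔n≤o⇒m≤o _ (randomness r) h) x
𝔼-run {m = suc m} (stochastic l r) (s≤s h) x = trans (𝔼-suc (run (stochastic l r) (s≤s h) x))
  (cong₂ (λ a b → ½ * (a + b)) (𝔼-run {m = m} l (m⊔n≤o⇒m≤o _ (randomness r) h) x)
                               (𝔼-run {m = m} r (m⊔n≤o⇒n≤o (randomness l) _ h) x))

-- The average label, with weight ½ for every branch.  On a read-once tree this is the expectation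
-- of val over a uniformly random input (𝔼-val).
mean : ∀ {n} → RDT n → ℚ
mean (leaf v _ _)     = v
mean (decision i l r) = ½ * (mean l + mean r)
mean (stochastic l r) = ½ * (mean l + mean r)

mean-≥0 : ∀ {n} (R : RDT n) → 0ℚ ≤ mean R
mean-≥0 (leaf v p q)     = p
mean-≥0 (decision i l r) = 0≤* 0≤½ (0≤+ (mean-≥0 l) (mean-≥0 r))
mean-≥0 (stochastic l r) = 0≤* 0≤½ (0≤+ (mean-≥0 l) (mean-≥0 r))

mean-≤1 : ∀ {n} (R : RDT n) → mean R ≤ 1ℚ
mean-≤1 (leaf v p q)     = q
mean-≤1 (decision i l r) = mean-mono (mean-≤1 l) (mean-≤1 r)
mean-≤1 (stochastic l r) = mean-mono (mean-≤1 l) (mean-≤1 r)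

------------------------------------------------------------------------
-- Restriction

-- The tree in which every query to x_i is answered by b.
restrict : ∀ {n} → Fin n → Bool → RDT n → RDT n
restrict i b (leaf v p q)     = leaf v p q
restrict i b (decision j l r) with i Fin.≟ j
... | yes _ = if b then restrict i b r else restrict i b l
... | no  _ = decision j (restrict i b l) (restrict i b r)
restrict i b (stochastic l r) = stochastic (restrict i b l) (restrict i b r)

-- No node of the tree queries x_i.
Avoids : ∀ {n} → Fin n → RDT n → Set
Avoids i (leaf _ _ _)     = ⊤
Avoids i (decision j l r) = i ≢ j × Avoids i l × Avoids i r
Avoids i (stochastic l r) = Avoids i l × Avoids i r

-- No variable is queried twice on a path.
ReadOnce : ∀ {n} → RDT n → Set
ReadOnce (leaf _ _ _)     = ⊤
ReadOnce (decision i l r) = (Avoids i l × Avoids i r) × ReadOnce l × ReadOnce r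
ReadOnce (stochastic l r) = ReadOnce l × ReadOnce r

val-restrict : ∀ {n} i b (R : RDT n) x → val (restrict i b R) x ≡ val R (x [ i ]≔ b)
val-restrict i b (leaf v p q) x = refl
val-restrict i b (decision j l r) x with i Fin.≟ j
val-restrict i true  (decision j l r) x | yes refl
  rewrite Vec.lookup∘updateAt i {λ _ → true} x = val-restrict i true r x
val-restrict i false (decision j l r) x | yes refl
  rewrite Vec.lookup∘updateAt i {λ _ → false} x = val-restrict i false l x
val-restrict i b (decision j l r) x | no i≢j
  rewrite Vec.lookup∘updateAt′ j i {λ _ → b} (i≢j ∘ sym) x with lookup x j
... | true  = val-restrict i b r x
... | false = val-restrict i b l x
val-restrict i b (stochastic l r) x =
  cong₂ (λ a b → ½ * (a + b)) (val-restrict i b l x) (val-restrict i b r x)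

restrict-avoided : ∀ {n} i b (R : RDT n) → Avoids i R → restrict i b R ≡ R
restrict-avoided i b (leaf v p q) _ = refl
restrict-avoided i b (decision j l r) (i≢j , al , ar) with i Fin.≟ j
... | yes i≡j = ⊥-elim (i≢j i≡j)
... | no  _   = cong₂ (decision j) (restrict-avoided i b l al) (restrict-avoided i b r ar)
restrict-avoided i b (stochastic l r) (al , ar) =
  cong₂ stochastic (restrict-avoided i b l al) (restrict-avoided i b r ar)

val-avoided : ∀ {n} i b (R : RDT n) → Avoids i R → ∀ x → val R (x [ i ]≔ b) ≡ val R x
val-avoided i b R a x =
  trans (sym (val-restrict i b R x)) (cong (λ T → val T x) (restrict-avoided i b R a))

restrict-avoids : ∀ {n} i b (R : RDT n) → Avoids i (restrict i b R)
restrict-avoids i b (leaf v p q) = tt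
restrict-avoids i b (decision j l r) with i Fin.≟ j
restrict-avoids i true  (decision j l r) | yes _ = restrict-avoids i true r
restrict-avoids i false (decision j l r) | yes _ = restrict-avoids i false l
restrict-avoids i b (decision j l r) | no i≢j =
  i≢j , restrict-avoids i b l , restrict-avoids i b r
restrict-avoids i b (stochastic l r) = restrict-avoids i b l , restrict-avoids i b r

avoids-restrict : ∀ {n} k i b (R : RDT n) → Avoids k R → Avoids k (restrict i b R)
avoids-restrict k i b (leaf v p q) _ = tt
avoids-restrict k i b (decision j l r) (k≢j , al , ar) with i Fin.≟ j
avoids-restrict k i true  (decision j l r) (k≢j , al , ar) | yes _ = avoids-restrict k i true r ar
avoids-restrict k i false (decision j l r) (k≢j , al , ar) | yes _ = avoids-restrict k i false l al
avoids-restrict k i b (decision j l r) (k≢j , al , ar) | no _ =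
  k≢j , avoids-restrict k i b l al , avoids-restrict k i b r ar
avoids-restrict k i b (stochastic l r) (al , ar) =
  avoids-restrict k i b l al , avoids-restrict k i b r ar

readOnce-restrict : ∀ {n} i b (R : RDT n) → ReadOnce R → ReadOnce (restrict i b R)
readOnce-restrict i b (leaf v p q) _ = tt
readOnce-restrict i b (decision j l r) ((al , ar) , cl , cr) with i Fin.≟ j
readOnce-restrict i true  (decision j l r) (_ , cl , cr) | yes _ = readOnce-restrict i true r cr
readOnce-restrict i false (decision j l r) (_ , cl , cr) | yes _ = readOnce-restrict i false l cl
readOnce-restrict i b (decision j l r) ((al , ar) , cl , cr) | no _ =
  (avoids-restrict j i b l al , avoids-restrict j i b r ar) ,
  readOnce-restrict i b l cl , readOnce-restrict i b r cr
readOnce-restrict i b (stochastic l r) (cl , cr) =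
  readOnce-restrict i b l cl , readOnce-restrict i b r cr

queryComplexity-restrict : ∀ {n} i b (R : RDT n) →
                           queryComplexity (restrict i b R) ℕ.≤ queryComplexity R
queryComplexity-restrict i b (leaf v p q) = z≤n
queryComplexity-restrict i b (decision j l r) with i Fin.≟ j
queryComplexity-restrict i true (decision j l r) | yes _ =
  ℕ.m≤n⇒m≤1+n (ℕ.≤-trans (queryComplexity-restrict i true r) (ℕ.m≤n⊔m (queryComplexity l) _))
queryComplexity-restrict i false (decision j l r) | yes _ =
  ℕ.m≤n⇒m≤1+n (ℕ.≤-trans (queryComplexity-restrict i false l) (ℕ.m≤m⊔n _ (queryComplexity r)))
queryComplexity-restrict i b (decision j l r) | no _ =
  s≤s (ℕ.⊔-mono-≤ (queryComplexity-restrict i b l) (queryComplexity-restrict i b r))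
queryComplexity-restrict i b (stochastic l r) =
  ℕ.⊔-mono-≤ (queryComplexity-restrict i b l) (queryComplexity-restrict i b r)

-- An equivalent read-once tree.  The subtrees are simplified before they are restricted, so that
-- the recursion is structural.
simplify : ∀ {n} → RDT n → RDT n
simplify (leaf v p q)     = leaf v p q
simplify (decision i l r) = decision i (restrict i false (simplify l)) (restrict i true (simplify r))
simplify (stochastic l r) = stochastic (simplify l) (simplify r)

simplify-readOnce : ∀ {n} (R : RDT n) → ReadOnce (simplify R)
simplify-readOnce (leaf v p q)     = tt
simplify-readOnce (decision i l r) =
  (restrict-avoids i false (simplify l) , restrict-avoids i true (simplify r)) ,
  readOnce-restrict i false (simplify l) (simplify-readOnce l) ,
  readOnce-restrict i true (simplify r) (simplify-readOnce r)
simplify-readOnce (stochastic l r) = simplify-readOnce l , simplify-readOnce r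

val-simplify : ∀ {n} (R : RDT n) x → val (simplify R) x ≡ val R x
val-simplify (leaf v p q) x = refl
val-simplify (decision i l r) x with lookup x i in eq
... | true  = trans (val-restrict i true (simplify r) x) (trans
  (cong (val (simplify r)) (trans (cong (x [ i ]≔_) (sym eq)) (Vec.[]≔-lookup x i))) (val-simplify r x))
... | false = trans (val-restrict i false (simplify l) x) (trans
  (cong (val (simplify l)) (trans (cong (x [ i ]≔_) (sym eq)) (Vec.[]≔-lookup x i))) (val-simplify l x))
val-simplify (stochastic l r) x =
  cong₂ (λ a b → ½ * (a + b)) (val-simplify l x) (val-simplify r x)

queryComplexity-simplify : ∀ {n} (R : RDT n) → queryComplexity (simplify R) ℕ.≤ queryComplexity R
queryComplexity-simplify (leaf v p q)     = z≤n
queryComplexity-simplify (decision i l r) = s≤s (ℕ.⊔-mono-≤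
  (ℕ.≤-trans (queryComplexity-restrict i false (simplify l)) (queryComplexity-simplify l))
  (ℕ.≤-trans (queryComplexity-restrict i true (simplify r)) (queryComplexity-simplify r)))
queryComplexity-simplify (stochastic l r) =
  ℕ.⊔-mono-≤ (queryComplexity-simplify l) (queryComplexity-simplify r)

-- In a read-once tree, the two subtrees of the root are the two restrictions of the function.
val-branch : ∀ {n} i (l r : RDT n) → ReadOnce (decision i l r) → ∀ b x →
             val (decision i l r) (x [ i ]≔ b) ≡ val (if b then r else l) x
val-branch i l r ((al , ar) , _) true  x
  rewrite Vec.lookup∘updateAt i {λ _ → true} x = val-avoided i true r ar x
val-branch i l r ((al , ar) , _) false x
  rewrite Vec.lookup∘updateAt i {λ _ → false} x = val-avoided i false l al x

𝔼-val : ∀ {n} (R : RDT n) → ReadOnce R → 𝔼 (val R) ≡ mean R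
𝔼-val {n} (leaf v p q) _ = 𝔼-const {n} v
𝔼-val (decision i l r) c@(_ , cl , cr) = trans (𝔼-split i (val (decision i l r)))
  (cong₂ (λ a b → ½ * (a + b)) (trans (𝔼-cong (val-branch i l r c false)) (𝔼-val l cl))
                               (trans (𝔼-cong (val-branch i l r c true)) (𝔼-val r cr)))
𝔼-val (stochastic l r) (cl , cr) = trans (𝔼-average (val l) (val r))
  (cong₂ (λ a b → ½ * (a + b)) (𝔼-val l cl) (𝔼-val r cr))

------------------------------------------------------------------------
-- Charges

-- The expected total charge of a run on uniformly random input, when each
-- query to x_j is charged φ j.  This is the true expectation only for
-- read-once trees, since the two outcomes of a query count ½ each.
charge : ∀ {n} → (Fin n → ℚ) → RDT n → ℚ
charge φ (leaf v _ _)     = 0ℚ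
charge φ (decision j l r) = φ j + ½ * (charge φ l + charge φ r)
charge φ (stochastic l r) = ½ * (charge φ l + charge φ r)

indicator : ∀ {n} → Fin n → Fin n → ℚ
indicator i j with i Fin.≟ j
... | yes _ = 1ℚ
... | no  _ = 0ℚ

-- The probability that a read-once tree queries x_i.
δ : ∀ {n} → Fin n → RDT n → ℚ
δ i = charge (indicator i)

-- The expected number of queries.
Δ : ∀ {n} → RDT n → ℚ
Δ = charge (λ _ → 1ℚ)

indicator-≥0 : ∀ {n} (i j : Fin n) → 0ℚ ≤ indicator i j
indicator-≥0 i j with i Fin.≟ j
... | yes _ = 0≤1
... | no  _ = ℚ.≤-refl

indicator-≤1 : ∀ {n} (i j : Fin n) → indicator i j ≤ 1ℚ
indicator-≤1 i j with i Fin.≟ j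
... | yes _ = ℚ.≤-refl
... | no  _ = 0≤1

charge-mono : ∀ {n} {φ ψ : Fin n → ℚ} → (∀ j → φ j ≤ ψ j) → ∀ R → charge φ R ≤ charge ψ R
charge-mono p (leaf v _ _)     = ℚ.≤-refl
charge-mono p (decision j l r) = ℚ.+-mono-≤ (p j) (mean-mono (charge-mono p l) (charge-mono p r))
charge-mono p (stochastic l r) = mean-mono (charge-mono p l) (charge-mono p r)

charge-≥0 : ∀ {n} {φ : Fin n → ℚ} → (∀ j → 0ℚ ≤ φ j) → ∀ R → 0ℚ ≤ charge φ R
charge-≥0 p (leaf v _ _)     = ℚ.≤-refl
charge-≥0 p (decision j l r) = 0≤+ (p j) (0≤* 0≤½ (0≤+ (charge-≥0 p l) (charge-≥0 p r)))
charge-≥0 p (stochastic l r) = 0≤* 0≤½ (0≤+ (charge-≥0 p l) (charge-≥0 p r))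

charge-+ : ∀ {n} (φ ψ : Fin n → ℚ) R → charge (λ j → φ j + ψ j) R ≡ charge φ R + charge ψ R
charge-+ φ ψ (leaf v _ _)     = refl
charge-+ φ ψ (decision j l r) rewrite charge-+ φ ψ l | charge-+ φ ψ r =
  solve 6 (λ p q a b c d → p :+ q :+ con ½ :* (a :+ b :+ (c :+ d)) :=
                           p :+ con ½ :* (a :+ c) :+ (q :+ con ½ :* (b :+ d))) refl
    (φ j) (ψ j) (charge φ l) (charge ψ l) (charge φ r) (charge ψ r)
charge-+ φ ψ (stochastic l r) rewrite charge-+ φ ψ l | charge-+ φ ψ r =
  solve 4 (λ a b c d → con ½ :* (a :+ b :+ (c :+ d)) :=
                       con ½ :* (a :+ c) :+ con ½ :* (b :+ d)) refl
    (charge φ l) (charge ψ l) (charge φ r) (charge ψ r)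

charge-const : ∀ {n} τ (R : RDT n) → charge (λ _ → τ) R ≡ τ * Δ R
charge-const τ (leaf v _ _)     = sym (ℚ.*-zeroʳ τ)
charge-const τ (decision j l r) rewrite charge-const τ l | charge-const τ r =
  solve 3 (λ t a b → t :+ con ½ :* (t :* a :+ t :* b) := t :* (con 1ℚ :+ con ½ :* (a :+ b))) refl
    τ (Δ l) (Δ r)
charge-const τ (stochastic l r) rewrite charge-const τ l | charge-const τ r =
  solve 3 (λ t a b → con ½ :* (t :* a :+ t :* b) := t :* (con ½ :* (a :+ b))) refl τ (Δ l) (Δ r)

Δ-≥0 : ∀ {n} (R : RDT n) → 0ℚ ≤ Δ R
Δ-≥0 = charge-≥0 (λ _ → 0≤1)

δ-≥0 : ∀ {n} i (R : RDT n) → 0ℚ ≤ δ i R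
δ-≥0 i = charge-≥0 (indicator-≥0 i)

δ-≤Δ : ∀ {n} i (R : RDT n) → δ i R ≤ Δ R
δ-≤Δ i = charge-mono (indicator-≤1 i)

average-≤-⊔ : ∀ {a b} m n → a ≤ fromℕ m → b ≤ fromℕ n → ½ * (a + b) ≤ fromℕ (m ℕ.⊔ n)
average-≤-⊔ m n p q = ℚ.≤-trans
  (mean-mono (ℚ.≤-trans p (fromℕ-mono (ℕ.m≤m⊔n m n))) (ℚ.≤-trans q (fromℕ-mono (ℕ.m≤n⊔m m n))))
  (ℚ.≤-reflexive (solve 1 (λ c → con ½ :* (c :+ c) := c) refl (fromℕ (m ℕ.⊔ n))))

Δ-≤queryComplexity : ∀ {n} (R : RDT n) → Δ R ≤ fromℕ (queryComplexity R)
Δ-≤queryComplexity (leaf v _ _)     = ℚ.≤-refl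
Δ-≤queryComplexity (decision j l r) =
  subst (Δ (decision j l r) ≤_) (sym (fromℕ-+ 1 (queryComplexity l ℕ.⊔ queryComplexity r)))
    (ℚ.+-monoʳ-≤ 1ℚ (average-≤-⊔ (queryComplexity l) (queryComplexity r)
                       (Δ-≤queryComplexity l) (Δ-≤queryComplexity r)))
Δ-≤queryComplexity (stochastic l r) =
  average-≤-⊔ (queryComplexity l) (queryComplexity r) (Δ-≤queryComplexity l) (Δ-≤queryComplexity r)

indicator-≢ : ∀ {n} {i j : Fin n} → i ≢ j → indicator i j ≡ 0ℚ
indicator-≢ {i = i} {j} i≢j with i Fin.≟ j
... | yes i≡j = ⊥-elim (i≢j i≡j)
... | no  _   = refl

δ-avoided : ∀ {n} i (R : RDT n) → Avoids i R → δ i R ≡ 0ℚ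
δ-avoided i (leaf v _ _)     _ = refl
δ-avoided i (decision j l r) (i≢j , al , ar)
  rewrite indicator-≢ i≢j | δ-avoided i l al | δ-avoided i r ar = refl
δ-avoided i (stochastic l r) (al , ar) rewrite δ-avoided i l al | δ-avoided i r ar = refl

-- Querying x_i first saves exactly the queries to x_i.
Δ-restrict : ∀ {n} i (R : RDT n) → ReadOnce R →
             Δ R ≡ ½ * (Δ (restrict i false R) + Δ (restrict i true R)) + δ i R
Δ-restrict i (leaf v _ _) _ = refl
Δ-restrict i (decision j l r) ((al , ar) , cl , cr) with i Fin.≟ j
... | yes refl
  rewrite restrict-avoided i false l al | restrict-avoided i true r ar
        | δ-avoided i l al | δ-avoided i r ar =
  solve 2 (λ a b → con 1ℚ :+ con ½ :* (a :+ b) :=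
                   con ½ :* (a :+ b) :+ (con 1ℚ :+ con ½ :* (con 0ℚ :+ con 0ℚ))) refl (Δ l) (Δ r)
... | no _ rewrite Δ-restrict i l cl | Δ-restrict i r cr =
  solve 6 (λ a b c d e f →
      con 1ℚ :+ con ½ :* (con ½ :* (a :+ b) :+ c :+ (con ½ :* (d :+ e) :+ f)) :=
      con ½ :* (con 1ℚ :+ con ½ :* (a :+ d) :+ (con 1ℚ :+ con ½ :* (b :+ e))) :+
      (con 0ℚ :+ con ½ :* (c :+ f))) refl
    (Δ (restrict i false l)) (Δ (restrict i true l)) (δ i l)
    (Δ (restrict i false r)) (Δ (restrict i true r)) (δ i r)
Δ-restrict i (stochastic l r) (cl , cr) rewrite Δ-restrict i l cl | Δ-restrict i r cr =
  solve 6 (λ a b c d e f →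
      con ½ :* (con ½ :* (a :+ b) :+ c :+ (con ½ :* (d :+ e) :+ f)) :=
      con ½ :* (con ½ :* (a :+ d) :+ con ½ :* (b :+ e)) :+ con ½ :* (c :+ f)) refl
    (Δ (restrict i false l)) (Δ (restrict i true l)) (δ i l)
    (Δ (restrict i false r)) (Δ (restrict i true r)) (δ i r)

------------------------------------------------------------------------
-- The variance bound

-- Restriction by a list of answers, the head being applied last.
restricts : ∀ {n} → List (Fin n × Bool) → RDT n → RDT n
restricts []            R = R
restricts ((i , b) ∷ ρ) R = restrict i b (restricts ρ R)

readOnce-restricts : ∀ {n} ρ {R : RDT n} → ReadOnce R → ReadOnce (restricts ρ R)
readOnce-restricts []            c = c
readOnce-restricts ((i , b) ∷ ρ) c = readOnce-restrict i b _ (readOnce-restricts ρ c)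

-- How often x_j occurs in the list; as a charge, it counts the queries to listed variables.
multiplicity : ∀ {n} → List (Fin n × Bool) → Fin n → ℚ
multiplicity []            j = 0ℚ
multiplicity ((i , _) ∷ ρ) j = indicator i j + multiplicity ρ j

multiplicity-≥0 : ∀ {n} (ρ : List (Fin n × Bool)) j → 0ℚ ≤ multiplicity ρ j
multiplicity-≥0 []            j = ℚ.≤-refl
multiplicity-≥0 ((i , _) ∷ ρ) j = 0≤+ (indicator-≥0 i j) (multiplicity-≥0 ρ j)

restricts-leaf : ∀ {n} ρ v p q → restricts {n} ρ (leaf v p q) ≡ leaf v p q
restricts-leaf []            v p q = refl
restricts-leaf ((i , b) ∷ ρ) v p q rewrite restricts-leaf ρ v p q = refl

restricts-stochastic : ∀ {n} ρ (l r : RDT n) →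
  restricts ρ (stochastic l r) ≡ stochastic (restricts ρ l) (restricts ρ r)
restricts-stochastic []            l r = refl
restricts-stochastic ((i , b) ∷ ρ) l r rewrite restricts-stochastic ρ l r = refl

-- A query at the root either survives or is to a listed variable.
restricts-decision : ∀ {n} ρ i (l r : RDT n) →
  1ℚ ≤ multiplicity ρ i ⊎
  restricts ρ (decision i l r) ≡ decision i (restricts ρ l) (restricts ρ r)
restricts-decision []            i l r = inj₂ refl
restricts-decision ((j , b) ∷ ρ) i l r with restricts-decision ρ i l r
... | inj₁ p = inj₁ (ℚ.≤-trans p (ℚ.≤-trans (≤-+ʳ (indicator-≥0 j i) ℚ.≤-refl)
                 (ℚ.≤-reflexive (ℚ.+-comm (multiplicity ρ i) (indicator j i)))))
... | inj₂ eq rewrite eq with j Fin.≟ i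
...   | yes _ = inj₁ (≤-+ʳ (multiplicity-≥0 ρ i) ℚ.≤-refl)
...   | no  _ = inj₂ refl

-- Fixing coordinates affects a run only if it queries one of them, and by at most 1.
mean-restricts : ∀ {n} ρ (R : RDT n) → mean (restricts ρ R) ≤ mean R + charge (multiplicity ρ) R
mean-restricts ρ (leaf v p q) rewrite restricts-leaf ρ v p q = ≤-+ʳ ℚ.≤-refl ℚ.≤-refl
mean-restricts ρ R@(decision i l r) with restricts-decision ρ i l r
... | inj₁ p = ℚ.≤-trans (mean-≤1 (restricts ρ R)) (ℚ.≤-trans
      (≤-+ʳ (0≤+ (mean-≥0 R) (charge-≥0 (multiplicity-≥0 ρ) (stochastic l r))) p)
      (ℚ.≤-reflexive (solve 3 (λ a b c → a :+ (b :+ c) := b :+ (a :+ c)) refl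
        (multiplicity ρ i) (mean R) (charge (multiplicity ρ) (stochastic l r)))))
... | inj₂ eq rewrite eq = ℚ.≤-trans (mean-mono (mean-restricts ρ l) (mean-restricts ρ r))
      (≤-diff (multiplicity ρ i) (multiplicity-≥0 ρ i)
        (solve 5 (λ m a b c d → con ½ :* (a :+ b) :+ (m :+ con ½ :* (c :+ d)) :=
                                con ½ :* (a :+ c :+ (b :+ d)) :+ m) refl
          (multiplicity ρ i) (mean l) (mean r)
          (charge (multiplicity ρ) l) (charge (multiplicity ρ) r)))
mean-restricts ρ (stochastic l r) rewrite restricts-stochastic ρ l r =
  ℚ.≤-trans (mean-mono (mean-restricts ρ l) (mean-restricts ρ r))
    (ℚ.≤-reflexive (solve 4 (λ a b c d → con ½ :* (a :+ c :+ (b :+ d)) :=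
                                         con ½ :* (a :+ b) :+ con ½ :* (c :+ d)) refl
      (mean l) (mean r) (charge (multiplicity ρ) l) (charge (multiplicity ρ) r)))

-- With ρ empty: the covariance of two trees is at most the expected number of coincidences between
-- the queries of independent runs of A and B.  In general, A is the subtree reached in a larger tree,
-- and ρ holds the answers on the way to it.  Since A is read-once, the answer at its root may be
-- moved to ρ; this adds δ i B to the bound of mean-restricts, which is weighted by mean A ≤ 1.
covariance : ∀ {n} ρ (A B : RDT n) → ReadOnce A → ReadOnce B →
  𝔼 (λ x → val A x * val (restricts ρ B) x) ≤
  mean A * (mean B + charge (multiplicity ρ) B) + charge (λ j → δ j B) A
covariance ρ (leaf v p q) B _ cB = ℚ.≤-trans
  (ℚ.≤-reflexive (trans (𝔼-scale v (val (restricts ρ B)))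
    (cong (v *_) (𝔼-val (restricts ρ B) (readOnce-restricts ρ cB)))))
  (≤-+ʳ ℚ.≤-refl (*-monoˡ p (mean-restricts ρ B)))
covariance ρ A@(decision i l r) B c@(_ , cl , cr) cB = ℚ.≤-trans
  (ℚ.≤-reflexive (trans (𝔼-split i (λ x → val A x * val (restricts ρ B) x))
    (cong₂ (λ a b → ½ * (a + b)) (𝔼-cong (branch false)) (𝔼-cong (branch true)))))
  (ℚ.≤-trans (mean-mono (covariance ((i , false) ∷ ρ) l B cl cB) (covariance ((i , true) ∷ ρ) r B cr cB))
  (subst (λ h → ½ * (mean l * (mean B + h) + charge (λ j → δ j B) l +
                    (mean r * (mean B + h) + charge (λ j → δ j B) r)) ≤
                mean A * (mean B + charge (multiplicity ρ) B) + charge (λ j → δ j B) A)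
    (sym (charge-+ (indicator i) (multiplicity ρ) B))
    (≤-diff (δ i B * (1ℚ - mean A)) (0≤* (δ-≥0 i B) (diff-≥0 (mean-≤1 A)))
      (solve 7 (λ a b m d h c₁ c₂ →
          con ½ :* (a :+ b) :* (m :+ h) :+ (d :+ con ½ :* (c₁ :+ c₂)) :=
          con ½ :* (a :* (m :+ (d :+ h)) :+ c₁ :+ (b :* (m :+ (d :+ h)) :+ c₂)) :+
          d :* (con 1ℚ :- con ½ :* (a :+ b))) refl
        (mean l) (mean r) (mean B) (δ i B) (charge (multiplicity ρ) B)
        (charge (λ j → δ j B) l) (charge (λ j → δ j B) r)))))
  where
  branch : ∀ b x → val A (x [ i ]≔ b) * val (restricts ρ B) (x [ i ]≔ b) ≡
                   val (if b then r else l) x * val (restricts ((i , b) ∷ ρ) B) x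
  branch b x = cong₂ _*_ (val-branch i l r c b x) (sym (val-restrict i b (restricts ρ B) x))
covariance ρ (stochastic l r) B (cl , cr) cB = ℚ.≤-trans
  (ℚ.≤-reflexive (trans
    (𝔼-cong (λ x → solve 3 (λ a b c → con ½ :* (a :+ b) :* c := con ½ :* (a :* c :+ b :* c)) refl
      (val l x) (val r x) (val (restricts ρ B) x)))
    (𝔼-average (λ x → val l x * val (restricts ρ B) x) (λ x → val r x * val (restricts ρ B) x))))
  (ℚ.≤-trans (mean-mono (covariance ρ l B cl cB) (covariance ρ r B cr cB))
  (ℚ.≤-reflexive (solve 5 (λ a b h c d → con ½ :* (a :* h :+ c :+ (b :* h :+ d)) :=
                                   con ½ :* (a :+ b) :* h :+ con ½ :* (c :+ d)) refl
    (mean l) (mean r) (mean B + charge (multiplicity ρ) B)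
    (charge (λ j → δ j B) l) (charge (λ j → δ j B) r))))

-- The variance of the function computed by a tree.
variance : ∀ {n} → RDT n → ℚ
variance R = 𝔼 (λ x → (mean R - val R x) ^ 2)

secondMoment : ∀ {n} → RDT n → ℚ
secondMoment R = 𝔼 (λ x → val R x * val R x)

variance-secondMoment : ∀ {n} (R : RDT n) → ReadOnce R →
                        variance R ≡ secondMoment R - mean R * mean R
variance-secondMoment {n} R c = trans
  (𝔼-cong (λ x → solve 2 (λ m v → (m :- v) :* ((m :- v) :* con 1ℚ) :=
      m :* (m :- (con 1ℚ :+ con 1ℚ) :* v) :+ con 1ℚ :* (v :* v)) refl m (val R x)))
  (trans (𝔼-linear m 1ℚ (λ x → m - (1ℚ + 1ℚ) * val R x) (λ x → val R x * val R x))
  (trans (cong (λ e → m * e + 1ℚ * secondMoment R) middle)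
  (solve 2 (λ m s → m :* (m :- (con 1ℚ :+ con 1ℚ) :* m) :+ con 1ℚ :* s := s :- m :* m) refl
    m (secondMoment R))))
  where
  m = mean R
  middle : 𝔼 (λ x → m - (1ℚ + 1ℚ) * val R x) ≡ m - (1ℚ + 1ℚ) * m
  middle = trans
    (𝔼-cong (λ x → solve 2 (λ m v → m :- (con 1ℚ :+ con 1ℚ) :* v :=
        con 1ℚ :* m :+ (con 0ℚ :- (con 1ℚ :+ con 1ℚ)) :* v) refl m (val R x)))
    (trans (𝔼-linear 1ℚ (0ℚ - (1ℚ + 1ℚ)) (λ _ → m) (val R))
    (trans (cong₂ (λ a b → 1ℚ * a + (0ℚ - (1ℚ + 1ℚ)) * b) (𝔼-const {n} m) (𝔼-val R c))
    (solve 1 (λ m → con 1ℚ :* m :+ (con 0ℚ :- (con 1ℚ :+ con 1ℚ)) :* m :=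
                    m :- (con 1ℚ :+ con 1ℚ) :* m) refl m)))

-- Since Δ is the total charge, a common bound on all δ j R bounds the variance.
variance-≤ : ∀ {n} (R : RDT n) → ReadOnce R → ∀ τ → (∀ j → δ j R ≤ τ) → variance R ≤ τ * Δ R
variance-≤ R c τ bound = ℚ.≤-trans (ℚ.≤-reflexive (variance-secondMoment R c))
  (ℚ.≤-trans (ℚ.+-monoˡ-≤ (- (mean R * mean R)) (covariance [] R R c c))
  (subst (λ h → mean R * (mean R + h) + charge (λ j → δ j R) R - mean R * mean R ≤ τ * Δ R)
    (sym (trans (charge-const 0ℚ R) (ℚ.*-zeroˡ (Δ R))))
  (ℚ.≤-trans (ℚ.≤-reflexive (solve 2 (λ m c → m :* (m :+ con 0ℚ) :+ c :- m :* m := c) refl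
                (mean R) (charge (λ j → δ j R) R)))
  (ℚ.≤-trans (charge-mono bound R) (ℚ.≤-reflexive (charge-const τ R))))))

-- The law of total variance; the difference is the variance of the mean given x_i.
variance-restrict : ∀ {n} i (R : RDT n) → ReadOnce R →
  ½ * (variance (restrict i false R) + variance (restrict i true R)) ≤ variance R
variance-restrict i R c = subst₂ _≤_
  (cong₂ (λ a b → ½ * (a + b)) (sym (variance-secondMoment R₀ (readOnce-restrict i false R c)))
                               (sym (variance-secondMoment R₁ (readOnce-restrict i true R c))))
  (sym (variance-secondMoment R c))
  (subst₂ (λ s m → ½ * (secondMoment R₀ - m₀ * m₀ + (secondMoment R₁ - m₁ * m₁)) ≤ s - m * m)
    (sym (trans (𝔼-split i (λ x → val R x * val R x)) (cong₂ (λ a b → ½ * (a + b)) (square false) (square true))))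
    (sym (trans (sym (𝔼-val R c)) (trans (𝔼-split i (val R))
      (cong₂ (λ a b → ½ * (a + b)) (expected false) (expected true)))))
    (≤-diff (½ * (m₀ - m₁) * (½ * (m₀ - m₁))) (0≤² (½ * (m₀ - m₁)))
      (solve 4 (λ s t a b →
          con ½ :* (s :+ t) :- con ½ :* (a :+ b) :* (con ½ :* (a :+ b)) :=
          con ½ :* (s :- a :* a :+ (t :- b :* b)) :+
          con ½ :* (a :- b) :* (con ½ :* (a :- b))) refl
        (secondMoment R₀) (secondMoment R₁) m₀ m₁)))
  where
  R₀ = restrict i false R
  R₁ = restrict i true R
  m₀ = mean R₀
  m₁ = mean R₁
  square : ∀ b → 𝔼 (λ x → val R (x [ i ]≔ b) * val R (x [ i ]≔ b)) ≡ secondMoment (restrict i b R)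
  square b = 𝔼-cong (λ x → cong (λ v → v * v) (sym (val-restrict i b R x)))
  expected : ∀ b → 𝔼 (λ x → val R (x [ i ]≔ b)) ≡ mean (restrict i b R)
  expected b = trans (𝔼-cong (λ x → sym (val-restrict i b R x)))
                     (𝔼-val (restrict i b R) (readOnce-restrict i b R c))

------------------------------------------------------------------------
-- The most likely query

-- w times 2 to the number of internal nodes, which is a multiple of 2 to the height.
scale : ∀ {n} → ℕ → RDT n → ℕ
scale w (leaf _ _ _)     = w
scale w (decision _ l r) = scale (scale (w ℕ.+ w) l) r
scale w (stochastic l r) = scale (scale (w ℕ.+ w) l) r

internal : ∀ {n} → RDT n → ℕ
internal (leaf _ _ _)     = 0
internal (decision _ l r) = suc (internal l ℕ.+ internal r)
internal (stochastic l r) = suc (internal l ℕ.+ internal r)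

-- The integer w (δ i R), when w is divisible by 2 to the height of the tree (weight-δ), so that the
-- halvings are exact.
weight : ∀ {n} → Fin n → ℕ → RDT n → ℕ
weight i w (leaf _ _ _)     = 0
weight i w (decision j l r) with i Fin.≟ j
... | yes _ = w ℕ.+ (weight i ⌊ w /2⌋ l ℕ.+ weight i ⌊ w /2⌋ r)
... | no  _ = 0 ℕ.+ (weight i ⌊ w /2⌋ l ℕ.+ weight i ⌊ w /2⌋ r)
weight i w (stochastic l r) = weight i ⌊ w /2⌋ l ℕ.+ weight i ⌊ w /2⌋ r

-- The score of a candidate variable; having no candidate scores 0.
score : ∀ {n} → ℕ → RDT n → Maybe (Fin n) → ℕ
score w R nothing  = 0
score w R (just i) = weight i w R

ifZero : {A : Set} → ℕ → A → A → A
ifZero zero    a b = a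
ifZero (suc _) a b = b

better : ∀ {n} → ℕ → RDT n → Maybe (Fin n) → Maybe (Fin n) → Maybe (Fin n)
better w R o o′ = ifZero (score w R o′ ℕ.∸ score w R o) o o′

-- A variable queried in T whose weight in R is greatest; nothing only if all these weights are 0.
best : ∀ {n} → ℕ → RDT n → RDT n → Maybe (Fin n)
best w R (leaf _ _ _)     = nothing
best w R (decision j l r) = better w R (just j) (better w R (best w R l) (best w R r))
best w R (stochastic l r) = better w R (best w R l) (best w R r)

-- A variable that R queries with the greatest probability; nothing if all probabilities are 0.
choose : ∀ {n} → RDT n → Maybe (Fin n)
choose R = ifZero (score (scale 1 R) R o) nothing o
  where o = best (scale 1 R) R R

scale-internal : ∀ {n} w (R : RDT n) → scale w R ≡ 2 ℕ.^ internal R ℕ.* w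
scale-internal-node : ∀ {n} w (l r : RDT n) →
                      scale (scale (w ℕ.+ w) l) r ≡ 2 ℕ.^ suc (internal l ℕ.+ internal r) ℕ.* w
scale-internal w (leaf _ _ _)     = sym (ℕ.*-identityˡ w)
scale-internal w (decision _ l r) = scale-internal-node w l r
scale-internal w (stochastic l r) = scale-internal-node w l r
scale-internal-node w l r
  rewrite scale-internal (scale (w ℕ.+ w) l) r | scale-internal (w ℕ.+ w) l
        | ℕ.^-distribˡ-+-* 2 (internal l) (internal r)
  = rearrange (2 ℕ.^ internal l) (2 ℕ.^ internal r) w
  where
  rearrange : ∀ a b w → b ℕ.* (a ℕ.* (w ℕ.+ w)) ≡ 2 ℕ.* (a ℕ.* b) ℕ.* w
  rearrange = solve-∀

halve : ∀ k → ⌊ 2 ℕ.^ suc k /2⌋ ≡ 2 ℕ.^ k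
halve k rewrite ℕ.+-identityʳ (2 ℕ.^ k) = sym (ℕ.n≡⌊n+n/2⌋ (2 ℕ.^ k))

fromℕ-2^suc : ∀ k → fromℕ (2 ℕ.^ suc k) ≡ fromℕ (2 ℕ.^ k) + fromℕ (2 ℕ.^ k)
fromℕ-2^suc k = trans (cong (λ a → fromℕ (2 ℕ.^ k ℕ.+ a)) (ℕ.+-identityʳ (2 ℕ.^ k)))
                      (fromℕ-+ (2 ℕ.^ k) (2 ℕ.^ k))

weight-δ : ∀ {n} i k (R : RDT n) → internal R ℕ.≤ k →
           fromℕ (weight i (2 ℕ.^ k) R) ≡ fromℕ (2 ℕ.^ k) * δ i R
weight-δ-children : ∀ {n} i k (l r : RDT n) → internal l ℕ.+ internal r ℕ.≤ k →
  fromℕ (weight i ⌊ 2 ℕ.^ suc k /2⌋ l ℕ.+ weight i ⌊ 2 ℕ.^ suc k /2⌋ r) ≡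
  fromℕ (2 ℕ.^ suc k) * (½ * (δ i l + δ i r))
weight-δ i k (leaf _ _ _) _ = sym (ℚ.*-zeroʳ (fromℕ (2 ℕ.^ k)))
weight-δ i (suc k) (decision j l r) (s≤s h) with i Fin.≟ j
... | yes _ = trans (fromℕ-+ (2 ℕ.^ suc k) children) (trans
      (cong (λ a → fromℕ (2 ℕ.^ suc k) + a) (weight-δ-children i k l r h))
      (solve 2 (λ w d → w :+ w :* d := w :* (con 1ℚ :+ d)) refl
        (fromℕ (2 ℕ.^ suc k)) (½ * (δ i l + δ i r))))
      where children = weight i ⌊ 2 ℕ.^ suc k /2⌋ l ℕ.+ weight i ⌊ 2 ℕ.^ suc k /2⌋ r
... | no  _ = trans (weight-δ-children i k l r h)
                    (cong (fromℕ (2 ℕ.^ suc k) *_) (sym (ℚ.+-identityˡ (½ * (δ i l + δ i r)))))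
weight-δ i (suc k) (stochastic l r) (s≤s h) = weight-δ-children i k l r h
weight-δ-children i k l r h rewrite halve k = trans
  (fromℕ-+ (weight i (2 ℕ.^ k) l) (weight i (2 ℕ.^ k) r)) (trans
  (cong₂ _+_ (weight-δ i k l (ℕ.m+n≤o⇒m≤o (internal l) h))
             (weight-δ i k r (ℕ.m+n≤o⇒n≤o (internal l) h))) (trans
  (solve 3 (λ w a b → w :* a :+ w :* b := (w :+ w) :* (con ½ :* (a :+ b))) refl
    (fromℕ (2 ℕ.^ k)) (δ i l) (δ i r))
  (cong (_* (½ * (δ i l + δ i r))) (sym (fromℕ-2^suc k)))))

weight-avoided : ∀ {n} i w (R : RDT n) → Avoids i R → weight i w R ≡ 0
weight-avoided i w (leaf _ _ _) _ = refl
weight-avoided i w (decision j l r) (i≢j , al , ar) with i Fin.≟ j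
... | yes i≡j = ⊥-elim (i≢j i≡j)
... | no  _
  rewrite weight-avoided i ⌊ w /2⌋ l al | weight-avoided i ⌊ w /2⌋ r ar = refl
weight-avoided i w (stochastic l r) (al , ar)
  rewrite weight-avoided i ⌊ w /2⌋ l al | weight-avoided i ⌊ w /2⌋ r ar = refl

better-≥ˡ : ∀ {n} w (R : RDT n) o o′ → score w R o ℕ.≤ score w R (better w R o o′)
better-≥ˡ w R o o′ with score w R o′ ℕ.∸ score w R o in eq
... | zero  = ℕ.≤-refl
... | suc _ with ℕ.≤-total (score w R o) (score w R o′)
...   | inj₁ p = p
...   | inj₂ p with () ← trans (sym eq) (ℕ.m≤n⇒m∸n≡0 p)

better-≥ʳ : ∀ {n} w (R : RDT n) o o′ → score w R o′ ℕ.≤ score w R (better w R o o′)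
better-≥ʳ w R o o′ with score w R o′ ℕ.∸ score w R o in eq
... | zero  = ℕ.m∸n≡0⇒m≤n eq
... | suc _ = ℕ.≤-refl

-- T is traversed while weights are measured in the whole tree R.
best-maximal : ∀ {n} w (R T : RDT n) i → Avoids i T ⊎ weight i w R ℕ.≤ score w R (best w R T)
best-maximal-children : ∀ {n} w (R l r : RDT n) i → (Avoids i l × Avoids i r) ⊎
  weight i w R ℕ.≤ score w R (better w R (best w R l) (best w R r))
best-maximal w R (leaf _ _ _)     i = inj₁ tt
best-maximal w R (decision j l r) i with i Fin.≟ j
... | yes refl = inj₂ (better-≥ˡ w R (just i) (better w R (best w R l) (best w R r)))
... | no  i≢j with best-maximal-children w R l r i
...   | inj₁ a = inj₁ (i≢j , a)
...   | inj₂ p = inj₂ (ℕ.≤-trans p (better-≥ʳ w R (just j) (better w R (best w R l) (best w R r))))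
best-maximal w R (stochastic l r) i = best-maximal-children w R l r i
best-maximal-children w R l r i with best-maximal w R l i | best-maximal w R r i
... | inj₂ p  | _       = inj₂ (ℕ.≤-trans p (better-≥ˡ w R (best w R l) (best w R r)))
... | inj₁ _  | inj₂ p  = inj₂ (ℕ.≤-trans p (better-≥ʳ w R (best w R l) (best w R r)))
... | inj₁ al | inj₁ ar = inj₁ (al , ar)

weight-best : ∀ {n} (R : RDT n) i →
              weight i (scale 1 R) R ℕ.≤ score (scale 1 R) R (best (scale 1 R) R R)
weight-best R i with best-maximal (scale 1 R) R R i
... | inj₁ a rewrite weight-avoided i (scale 1 R) R a = z≤n
... | inj₂ p = p

weight-scale : ∀ {n} (R : RDT n) i →
               fromℕ (weight i (scale 1 R) R) ≡ fromℕ (2 ℕ.^ internal R) * δ i R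
weight-scale R i
  rewrite trans (scale-internal 1 R) (ℕ.*-identityʳ (2 ℕ.^ internal R)) = weight-δ i _ R ℕ.≤-refl

δ-mono-weight : ∀ {n} (R : RDT n) i τ → fromℕ (weight i (scale 1 R) R) ≤ fromℕ (2 ℕ.^ internal R) * τ →
                δ i R ≤ τ
δ-mono-weight R i τ p = ℚ.*-cancelˡ-≤-pos (fromℕ (2 ℕ.^ internal R))
  {{positive (0<fromℕ (2 ℕ.^ internal R) {{ℕ.m^n≢0 2 (internal R)}})}}
  (subst (_≤ _) (weight-scale R i) p)

δ-≤0 : ∀ {n} (R : RDT n) → score (scale 1 R) R (best (scale 1 R) R R) ≡ 0 → ∀ i → δ i R ≤ 0ℚ
δ-≤0 R z i = δ-mono-weight R i 0ℚ (ℚ.≤-trans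
  (fromℕ-mono (subst (weight i (scale 1 R) R ℕ.≤_) z (weight-best R i)))
  (ℚ.≤-reflexive (sym (ℚ.*-zeroʳ (fromℕ (2 ℕ.^ internal R))))))

δ-≤best : ∀ {n} (R : RDT n) {i} → best (scale 1 R) R R ≡ just i → ∀ j → δ j R ≤ δ i R
δ-≤best R {i} eq j = δ-mono-weight R j (δ i R)
  (subst (fromℕ (weight j (scale 1 R) R) ≤_) (weight-scale R i)
    (fromℕ-mono (subst (λ o → weight j (scale 1 R) R ℕ.≤ score (scale 1 R) R o) eq (weight-best R j))))

-- The two ways in which a round can go: either every variable has weight 0, or x_i
-- is queried.
data Round {n} (R : RDT n) : Set where
  stop : choose R ≡ nothing → score (scale 1 R) R (best (scale 1 R) R R) ≡ 0 → Round R
  ask  : ∀ i → choose R ≡ just i → best (scale 1 R) R R ≡ just i → weight i (scale 1 R) R ≢ 0 → Round R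

round : ∀ {n} (R : RDT n) → Round R
round R = go (best (scale 1 R) R R) refl
  where
  go : ∀ o → best (scale 1 R) R R ≡ o → Round R
  go nothing  eq = stop chosen (cong (score (scale 1 R) R) eq)
    where
    chosen : choose R ≡ nothing
    chosen rewrite eq = refl
  go (just i) eq with weight i (scale 1 R) R ℕ.≟ 0
  ... | yes z = stop chosen (trans (cong (score (scale 1 R) R) eq) z)
    where
    chosen : choose R ≡ nothing
    chosen rewrite eq | z = refl
  ... | no nz = ask i (chosen nz) eq nz
    where
    chosen : weight i (scale 1 R) R ≢ 0 → choose R ≡ just i
    chosen nz rewrite eq with weight i (scale 1 R) R
    ... | zero  = ⊥-elim (nz refl)
    ... | suc _ = refl

------------------------------------------------------------------------
-- The greedy strategy

-- The answer on x after at most D rounds.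
answer : ∀ {n} → ℕ → RDT n → Vec Bool n → ℚ
answer zero    R x = mean R
answer (suc D) R x with choose R
... | nothing = mean R
... | just i  = answer D (restrict i (lookup x i) R) x

answer-stop : ∀ {n} D (R : RDT n) x → choose R ≡ nothing → answer (suc D) R x ≡ mean R
answer-stop D R x eq rewrite eq = refl

answer-ask : ∀ {n} D (R : RDT n) x {i} → choose R ≡ just i →
             answer (suc D) R x ≡ answer D (restrict i (lookup x i) R) x
answer-ask D R x eq rewrite eq = refl

answer-bounds : ∀ {n} D (R : RDT n) x → 0ℚ ≤ answer D R x × answer D R x ≤ 1ℚ
answer-bounds zero    R x = mean-≥0 R , mean-≤1 R
answer-bounds (suc D) R x with choose R
... | nothing = mean-≥0 R , mean-≤1 R
... | just i  = answer-bounds D (restrict i (lookup x i) R) x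

-- Once queried, a coordinate is irrelevant for the later rounds.
answer-avoided : ∀ {n} D i b (R : RDT n) → Avoids i R → ∀ x → answer D R (x [ i ]≔ b) ≡ answer D R x
answer-avoided zero    i b R a x = refl
answer-avoided (suc D) i b R a x with round R
... | stop eq _ = trans (answer-stop D R (x [ i ]≔ b) eq) (sym (answer-stop D R x eq))
... | ask j eq _ weight≢0 = trans (answer-ask D R (x [ i ]≔ b) eq) (trans step (sym (answer-ask D R x eq)))
  where
  j≢i : j ≢ i
  j≢i refl = weight≢0 (weight-avoided i (scale 1 R) R a)
  step : answer D (restrict j (lookup (x [ i ]≔ b) j) R) (x [ i ]≔ b) ≡ answer D (restrict j (lookup x j) R) x
  step rewrite Vec.lookup∘updateAt′ j i {λ _ → b} j≢i x =
    answer-avoided D i b (restrict j (lookup x j) R) (avoids-restrict i j (lookup x j) R a) x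

-- The mean squared error after at most D rounds.
error : ∀ {n} → ℕ → RDT n → ℚ
error D R = 𝔼 (λ x → (answer D R x - val R x) ^ 2)

error-stop : ∀ {n} D (R : RDT n) → choose R ≡ nothing → error (suc D) R ≡ variance R
error-stop D R eq = 𝔼-cong λ x → cong (λ a → (a - val R x) ^ 2) (answer-stop D R x eq)

error-ask : ∀ {n} D (R : RDT n) {i} → choose R ≡ just i →
            error (suc D) R ≡ ½ * (error D (restrict i false R) + error D (restrict i true R))
error-ask D R {i} eq = trans (𝔼-split i (λ x → (answer (suc D) R x - val R x) ^ 2))
  (cong₂ (λ a b → ½ * (a + b)) (𝔼-cong (branch false)) (𝔼-cong (branch true)))
  where
  answer-branch : ∀ b x → answer (suc D) R (x [ i ]≔ b) ≡ answer D (restrict i b R) x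
  answer-branch b x = trans (answer-ask D R (x [ i ]≔ b) eq) (trans
    (cong (λ c → answer D (restrict i c R) (x [ i ]≔ b)) (Vec.lookup∘updateAt i {λ _ → b} x))
    (answer-avoided D i b (restrict i b R) (restrict-avoids i b R) x))
  branch : ∀ b x → (answer (suc D) R (x [ i ]≔ b) - val R (x [ i ]≔ b)) ^ 2 ≡
                   (answer D (restrict i b R) x - val (restrict i b R) x) ^ 2
  branch b x = cong₂ (λ a v → (a - v) ^ 2) (answer-branch b x) (sym (val-restrict i b R x))

error-≤variance : ∀ {n} D (R : RDT n) → ReadOnce R → error D R ≤ variance R
error-≤variance zero    R c = ℚ.≤-refl
error-≤variance (suc D) R c with round R
... | stop eq _ = ℚ.≤-reflexive (error-stop D R eq)
... | ask i eq _ _ = ℚ.≤-trans (ℚ.≤-reflexive (error-ask D R eq)) (ℚ.≤-trans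
  (mean-mono (error-≤variance D (restrict i false R) (readOnce-restrict i false R c))
             (error-≤variance D (restrict i true R) (readOnce-restrict i true R c)))
  (variance-restrict i R c))

δ-≤q : ∀ {n} q (R : RDT n) → queryComplexity R ℕ.≤ q → ∀ j → δ j R ≤ fromℕ q
δ-≤q q R h j = ℚ.≤-trans (δ-≤Δ j R) (ℚ.≤-trans (Δ-≤queryComplexity R) (fromℕ-mono h))

-- Amortization: of the D + 2 copies of the error after D + 1 rounds, D + 1 are covered by the
-- induction hypothesis for the two restrictions.  The remaining copy is at most the variance, and
-- is covered by the drop of Δ in the first round.
error-≤ : ∀ {n} D q (R : RDT n) → ReadOnce R → queryComplexity R ℕ.≤ q →
          fromℕ (suc D) * error D R ≤ fromℕ q * Δ R
error-≤ zero q R c h = ℚ.≤-trans (ℚ.≤-reflexive (ℚ.*-identityˡ (variance R)))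
  (variance-≤ R c (fromℕ q) (δ-≤q q R h))
error-≤ (suc D) q R c h with round R
... | stop eq z = ℚ.≤-trans
  (*-monoˡ (0≤fromℕ (2 ℕ.+ D)) (ℚ.≤-trans (ℚ.≤-reflexive (error-stop D R eq)) (variance-≤ R c 0ℚ (δ-≤0 R z))))
  (ℚ.≤-trans (ℚ.≤-reflexive (solve 2 (λ a b → a :* (con 0ℚ :* b) := con 0ℚ) refl (fromℕ (2 ℕ.+ D)) (Δ R)))
  (0≤* (0≤fromℕ q) (Δ-≥0 R)))
... | ask i eq isBest _ = ℚ.≤-trans
  (ℚ.≤-reflexive (trans (cong₂ _*_ (fromℕ-+ 1 (suc D)) (error-ask D R eq))
    (solve 3 (λ d a b → (con 1ℚ :+ d) :* (con ½ :* (a :+ b)) :=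
                        con ½ :* (d :* a :+ d :* b) :+ con ½ :* (a :+ b)) refl
      (fromℕ (suc D)) (error D R₀) (error D R₁))))
  (ℚ.≤-trans (ℚ.+-mono-≤
    (mean-mono (error-≤ D q R₀ (readOnce-restrict i false R c) (ℕ.≤-trans (queryComplexity-restrict i false R) h))
               (error-≤ D q R₁ (readOnce-restrict i true R c) (ℕ.≤-trans (queryComplexity-restrict i true R) h)))
    (ℚ.≤-trans (ℚ.≤-reflexive (sym (error-ask D R eq)))
    (ℚ.≤-trans (error-≤variance (suc D) R c)
    (ℚ.≤-trans (variance-≤ R c (δ i R) (δ-≤best R isBest))
    (*-monoˡ (δ-≥0 i R) (ℚ.≤-trans (Δ-≤queryComplexity R) (fromℕ-mono h)))))))
  (ℚ.≤-reflexive (trans (solve 4 (λ q a b d → con ½ :* (q :* a :+ q :* b) :+ d :* q :=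
                                      q :* (con ½ :* (a :+ b) :+ d)) refl
      (fromℕ q) (Δ R₀) (Δ R₁) (δ i R))
    (cong (fromℕ q *_) (sym (Δ-restrict i R c))))))
  where
  R₀ = restrict i false R
  R₁ = restrict i true R

------------------------------------------------------------------------
-- The number of rounds

nonneg-fraction : ∀ v → 0ℚ ≤ v → v * fromℕ (↧ₙ v) ≡ fromℕ ℤ.∣ ↥ v ∣
nonneg-fraction v@(mkℚ (+ a) d _) _ =
  subst (λ u → u * fromℕ (suc d) ≡ fromℕ a) (ℚ.↥p/↧p≡p v) (/-cancel a (suc d))
nonneg-fraction (mkℚ ℤ.-[1+ a ] d _) (*≤* ())

-- Subtracting the price a from the budget β until nothing is left takes D rounds.  So D is β / a
-- rounded up.
data Rounds (a : ℕ) : ℕ → ℕ → Set where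
  done : Rounds a 0 0
  more : ∀ {β D} → Rounds a (suc β ℕ.∸ a) D → Rounds a (suc β) (suc D)

rounds-exist : ∀ a .{{_ : ℕ.NonZero a}} β → ∃[ D ] Rounds a β D
rounds-exist (suc a) β = go β β ℕ.≤-refl
  where
  -- The fuel makes the recursion on the remaining budget structural.
  go : ∀ fuel β → β ℕ.≤ fuel → ∃[ D ] Rounds (suc a) β D
  go fuel zero h = 0 , done
  go (suc fuel) (suc β) (s≤s h) with go fuel (β ℕ.∸ a) (ℕ.≤-trans (ℕ.m∸n≤m β a) h)
  ... | D , r = suc D , more r

rounds-lower : ∀ {a β D} → Rounds a β D → β ℕ.≤ D ℕ.* a
rounds-lower done = z≤n
rounds-lower {a} (more {β} r) = ℕ.≤-trans (ℕ.m≤n+m∸n (suc β) a) (ℕ.+-monoʳ-≤ a (rounds-lower r))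

rounds-upper : ∀ {a β D} → Rounds a β D → D ℕ.* a ℕ.≤ β ℕ.+ a
rounds-upper done = z≤n
rounds-upper {a} (more {β} {D} r) with ℕ.≤-total (suc β) a
... | inj₂ p = ℕ.≤-trans (ℕ.+-monoʳ-≤ a (rounds-upper r)) (ℕ.≤-reflexive
      (trans (cong (a ℕ.+_) (ℕ.m∸n+n≡m p)) (ℕ.+-comm a (suc β))))
... | inj₁ p with D | subst (λ β → Rounds a β D) (ℕ.m≤n⇒m∸n≡0 p) r
...   | .0 | done = ℕ.≤-trans (ℕ.≤-reflexive (ℕ.+-identityʳ a)) (ℕ.m≤n+m a (suc β))

numerator-nonZero : ∀ ε → 0ℚ < ε → ℕ.NonZero ℤ.∣ ↥ ε ∣
numerator-nonZero (mkℚ (+ suc _) _ _)    _                = _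
numerator-nonZero (mkℚ ℤ.-[1+ _ ] _ _)   _                = _
numerator-nonZero (mkℚ (+ zero) _ _)     (*<* (ℤ.+<+ ()))

price-fraction : ∀ ε → 0ℚ < ε → ∀ D → fromℕ (D ℕ.* ℤ.∣ ↥ ε ∣) ≡ fromℕ D * ε * fromℕ (↧ₙ ε)
price-fraction ε ε>0 D = trans (fromℕ-* D ℤ.∣ ↥ ε ∣) (trans
  (cong (fromℕ D *_) (sym (nonneg-fraction ε (ℚ.<⇒≤ ε>0))))
  (sym (ℚ.*-assoc (fromℕ D) ε (fromℕ (↧ₙ ε)))))

-- The budget is q q and the price ε, both multiplied by the denominator of ε.
rounds-≥ : ∀ ε → 0ℚ < ε → ∀ q {D} → Rounds ℤ.∣ ↥ ε ∣ (↧ₙ ε ℕ.* (q ℕ.* q)) D →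
           fromℕ q * fromℕ q ≤ fromℕ D * ε
rounds-≥ ε@(mkℚ _ _ _) ε>0 q {D} r = ℚ.*-cancelʳ-≤-pos (fromℕ (↧ₙ ε))
  {{positive (0<fromℕ (↧ₙ ε))}}
  (subst₂ _≤_ budget (price-fraction ε ε>0 D) (fromℕ-mono (rounds-lower r)))
  where
  budget : fromℕ (↧ₙ ε ℕ.* (q ℕ.* q)) ≡ fromℕ q * fromℕ q * fromℕ (↧ₙ ε)
  budget = trans (fromℕ-* (↧ₙ ε) (q ℕ.* q)) (trans (ℚ.*-comm (fromℕ (↧ₙ ε)) (fromℕ (q ℕ.* q)))
    (cong (_* fromℕ (↧ₙ ε)) (fromℕ-* q q)))

rounds-≤ : ∀ ε → 0ℚ < ε → ∀ q {D} → Rounds ℤ.∣ ↥ ε ∣ (↧ₙ ε ℕ.* (q ℕ.* q)) D →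
           fromℕ D * ε ≤ fromℕ q * fromℕ q + ε
rounds-≤ ε@(mkℚ _ _ _) ε>0 q {D} r = ℚ.*-cancelʳ-≤-pos (fromℕ (↧ₙ ε))
  {{positive (0<fromℕ (↧ₙ ε))}}
  (subst₂ _≤_ (price-fraction ε ε>0 D) budget (fromℕ-mono (rounds-upper r)))
  where
  budget : fromℕ (↧ₙ ε ℕ.* (q ℕ.* q) ℕ.+ ℤ.∣ ↥ ε ∣) ≡ (fromℕ q * fromℕ q + ε) * fromℕ (↧ₙ ε)
  budget = trans (fromℕ-+ (↧ₙ ε ℕ.* (q ℕ.* q)) ℤ.∣ ↥ ε ∣) (trans
    (cong₂ _+_ (trans (fromℕ-* (↧ₙ ε) (q ℕ.* q)) (cong (fromℕ (↧ₙ ε) *_) (fromℕ-* q q)))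
               (sym (nonneg-fraction ε (ℚ.<⇒≤ ε>0))))
    (solve 3 (λ b q e → b :* (q :* q) :+ e :* b := (q :* q :+ e) :* b) refl
      (fromℕ (↧ₙ ε)) (fromℕ q) ε))

1≤* : ∀ {a b} → 1ℚ ≤ a → 1ℚ ≤ b → 1ℚ ≤ a * b
1≤* {a} p q = ℚ.≤-trans p (ℚ.≤-trans (ℚ.≤-reflexive (sym (ℚ.*-identityʳ a))) (*-monoˡ (ℚ.≤-trans 0≤1 p) q))

*-mono : ∀ {a b c d} → 0ℚ ≤ a → 0ℚ ≤ d → a ≤ b → c ≤ d → a * c ≤ b * d
*-mono {a} {b} {c} {d} p q h h′ = ℚ.≤-trans (*-monoˡ p h′) (ℚ.*-monoʳ-≤-nonNeg d {{nonNegative q}} h)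

^2-mono : ∀ {a b} → 0ℚ ≤ a → a ≤ b → a ^ 2 ≤ b ^ 2
^2-mono p h = *-mono p (0≤* (ℚ.≤-trans p h) 0≤1) h (*-mono p 0≤1 h ℚ.≤-refl)

^3-mono : ∀ {a b} → 0ℚ ≤ a → a ≤ b → a ^ 3 ≤ b ^ 3
^3-mono {a} {b} p h = *-mono p (0≤* q (0≤* q 0≤1)) h (^2-mono p h)
  where
  q : 0ℚ ≤ b
  q = ℚ.≤-trans p h

-- Here e is the inverse of ε.  Rounding up costs at most one round, hence a factor 2 if q₀ ≥ 1;
-- for q₀ = 0 there are no rounds.
queries-≤ : ∀ ε → 0ℚ < ε → ε ≤ 1ℚ → ∀ e → ε * e ≡ 1ℚ → ∀ q₀ q {D} → q₀ ℕ.≤ q →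
  Rounds ℤ.∣ ↥ ε ∣ (↧ₙ ε ℕ.* (q₀ ℕ.* q₀)) D → fromℕ D ≤ fromℕ 2 * (fromℕ q ^ 2 * e ^ 3)
queries-≤ ε ε>0 ε≤1 e inverse zero q h r with ↧ₙ ε ℕ.* 0 | ℕ.*-zeroʳ (↧ₙ ε)
queries-≤ ε ε>0 ε≤1 e inverse zero q {.0} h done | .0 | refl =
  0≤* (0≤fromℕ 2) (0≤* (0≤* (0≤fromℕ q) (0≤* (0≤fromℕ q) 0≤1)) (0≤* e≥0 (0≤* e≥0 (0≤* e≥0 0≤1))))
  where
  e≥0 : 0ℚ ≤ e
  e≥0 = ℚ.*-cancelˡ-≤-pos ε {{positive ε>0}}
    (subst₂ _≤_ (sym (ℚ.*-zeroʳ ε)) (sym inverse) 0≤1)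
queries-≤ ε ε>0 ε≤1 e inverse q₀@(suc _) q {D} h r = ℚ.≤-trans
  (ℚ.≤-reflexive (trans (sym (ℚ.*-identityʳ (fromℕ D))) (trans (cong (fromℕ D *_) (sym inverse))
    (sym (ℚ.*-assoc (fromℕ D) ε e)))))
  (ℚ.≤-trans (ℚ.*-monoʳ-≤-nonNeg e {{nonNegative e≥0}} (rounds-≤ ε ε>0 q₀ r))
  (ℚ.≤-trans (ℚ.≤-reflexive (trans (ℚ.*-distribʳ-+ e (fromℕ q₀ * fromℕ q₀) ε)
      (cong (λ z → fromℕ q₀ * fromℕ q₀ * e + z) inverse)))
  (ℚ.≤-trans (ℚ.+-mono-≤ main one)
    (ℚ.≤-reflexive (solve 1 (λ a → a :+ a := (con 1ℚ :+ con 1ℚ) :* a) refl (fromℕ q ^ 2 * e ^ 3))))))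
  where
  e≥1 : 1ℚ ≤ e
  e≥1 = ℚ.*-cancelˡ-≤-pos ε {{positive ε>0}}
    (subst₂ _≤_ (sym (ℚ.*-identityʳ ε)) (sym inverse) ε≤1)
  e≥0 : 0ℚ ≤ e
  e≥0 = ℚ.≤-trans 0≤1 e≥1
  q≥1 : 1ℚ ≤ fromℕ q
  q≥1 = fromℕ-mono {1} {q} (ℕ.≤-trans (s≤s z≤n) h)
  one : 1ℚ ≤ fromℕ q ^ 2 * e ^ 3
  one = 1≤* (1≤* q≥1 (1≤* q≥1 ℚ.≤-refl)) (1≤* e≥1 (1≤* e≥1 (1≤* e≥1 ℚ.≤-refl)))
  e≤e³ : e ≤ e ^ 3
  e≤e³ = subst (_≤ e ^ 3) (ℚ.*-identityʳ e) (*-monoˡ e≥0 (1≤* e≥1 (1≤* e≥1 ℚ.≤-refl)))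
  main : fromℕ q₀ * fromℕ q₀ * e ≤ fromℕ q ^ 2 * e ^ 3
  main = *-mono (0≤* (0≤fromℕ q₀) (0≤fromℕ q₀)) (0≤* e≥0 (0≤* e≥0 (0≤* e≥0 0≤1)))
    (subst (_≤ fromℕ q ^ 2) (cong (fromℕ q₀ *_) (ℚ.*-identityʳ (fromℕ q₀)))
      (^2-mono (0≤fromℕ q₀) (fromℕ-mono h))) e≤e³

time-≤ : ∀ t c N q e → 0ℚ ≤ e → t ℕ.≤ c ℕ.* (N ℕ.* (N ℕ.* N)) →
         fromℕ t ≤ fromℕ c * (fromℕ N + fromℕ q + e) ^ 3
time-≤ t c N q e e≥0 h = ℚ.≤-trans (fromℕ-mono h) (ℚ.≤-trans
  (ℚ.≤-reflexive (trans (fromℕ-* c (N ℕ.* (N ℕ.* N))) (cong (fromℕ c *_)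
    (trans (fromℕ-* N (N ℕ.* N)) (cong (fromℕ N *_) (trans (fromℕ-* N N)
      (cong (fromℕ N *_) (sym (ℚ.*-identityʳ (fromℕ N))))))))))
  (*-monoˡ (0≤fromℕ c) (^3-mono (0≤fromℕ N) (≤-+ʳ e≥0 (≤-+ʳ (0≤fromℕ q) ℚ.≤-refl)))))

answer-error : ∀ {n} (R : RDT n) ε → 0ℚ < ε → ∀ {D} →
  Rounds ℤ.∣ ↥ ε ∣ (↧ₙ ε ℕ.* (queryComplexity R ℕ.* queryComplexity R)) D → error D (simplify R) ≤ ε
answer-error R ε ε>0 {D} r = ℚ.*-cancelˡ-≤-pos (fromℕ (suc D)) {{positive (0<fromℕ (suc D))}}
  (ℚ.≤-trans (error-≤ D q (simplify R) (simplify-readOnce R) (queryComplexity-simplify R))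
  (ℚ.≤-trans (*-monoˡ (0≤fromℕ q) (ℚ.≤-trans (Δ-≤queryComplexity (simplify R)) (fromℕ-mono (queryComplexity-simplify R))))
  (ℚ.≤-trans (rounds-≥ ε ε>0 q r)
  (ℚ.*-monoʳ-≤-nonNeg ε {{nonNegative (ℚ.<⇒≤ ε>0)}} (fromℕ-mono (ℕ.n≤1+n D))))))
  where q = queryComplexity R

------------------------------------------------------------------------
-- The program

-- Parts of an encoded tree, by the kind of its root.
index leftOfQuery rightOfQuery leftOfCoin rightOfCoin : ∀ {p n} → Expr p n → Expr p n
index        e = fst (snd e)
leftOfQuery  e = fst (snd (snd e))
rightOfQuery e = snd (snd (snd e))
leftOfCoin   e = fst (snd e)
rightOfCoin  e = snd (snd e)

-- Case distinction on the root of an encoded tree: leaf, query or random bit.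
caseTree : ∀ {p n} → Expr p n → Expr p n → Expr p n → Expr p n → Expr p n
caseTree e a b c = ifzero fst e then a else (ifzero monus (fst e) (lit 1) then b else c)

-- Zero exactly when the two numbers are equal.
distance : ∀ {p n} → Expr p n → Expr p n → Expr p n
distance e e′ = add (monus e e′) (monus e′ e)

arg : ∀ {p} → Expr p 1
arg = var 0F

pattern restrictᶠ   = 1F
pattern simplifyᶠ   = 2F
pattern complexityᶠ = 3F
pattern scaleᶠ      = 4F
pattern weightᶠ     = 5F
pattern betterᶠ     = 6F
pattern bestᶠ       = 7F
pattern productᶠ    = 8F
pattern meanᶠ       = 9F
pattern averageᶠ    = fsuc 9F
pattern roundsᶠ     = fsuc (fsuc 9F)

-- Expressions over the twelve functions of the program.
Code : ℕ → Set
Code = Expr 12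

-- Argument ((i , b) , R).
restrictCode : Code 1
restrictCode = caseTree R R
  (ifzero distance (fst (fst arg)) (index R)
   then ifzero snd (fst arg) then call restrictᶠ (cons (fst arg) (leftOfQuery R))
                             else call restrictᶠ (cons (fst arg) (rightOfQuery R))
   else cons (lit 1) (cons (index R)
          (cons (call restrictᶠ (cons (fst arg) (leftOfQuery R)))
                (call restrictᶠ (cons (fst arg) (rightOfQuery R))))))
  (cons (lit 2) (cons (call restrictᶠ (cons (fst arg) (leftOfCoin R)))
                      (call restrictᶠ (cons (fst arg) (rightOfCoin R)))))
  where R = snd arg

-- Argument R.
simplifyCode : Code 1
simplifyCode = caseTree arg arg
  (cons (lit 1) (cons (index arg)
    (cons (call restrictᶠ (cons (cons (index arg) (lit 0)) (call simplifyᶠ (leftOfQuery arg))))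
          (call restrictᶠ (cons (cons (index arg) (lit 1)) (call simplifyᶠ (rightOfQuery arg)))))))
  (cons (lit 2) (cons (call simplifyᶠ (leftOfCoin arg)) (call simplifyᶠ (rightOfCoin arg))))

maximum : ∀ {n} → Code n → Code n → Code n
maximum e e′ = let′ (cons e e′)
  (add (fst (var 0F)) (monus (snd (var 0F)) (fst (var 0F))))

-- Argument R.
complexityCode : Code 1
complexityCode = caseTree arg (lit 0)
  (add (lit 1) (maximum (call complexityᶠ (leftOfQuery arg)) (call complexityᶠ (rightOfQuery arg))))
  (maximum (call complexityᶠ (leftOfCoin arg)) (call complexityᶠ (rightOfCoin arg)))

-- Argument (w , R).
scaleCode : Code 1
scaleCode = caseTree R (fst arg)
  (call scaleᶠ (cons (call scaleᶠ (cons (add (fst arg) (fst arg)) (leftOfQuery R))) (rightOfQuery R)))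
  (call scaleᶠ (cons (call scaleᶠ (cons (add (fst arg) (fst arg)) (leftOfCoin R))) (rightOfCoin R)))
  where R = snd arg

-- Argument ((i , w) , R).
weightCode : Code 1
weightCode = caseTree R (lit 0)
  (add (ifzero distance (fst (fst arg)) (index R) then snd (fst arg) else lit 0)
       (add (call weightᶠ (cons halved (leftOfQuery R))) (call weightᶠ (cons halved (rightOfQuery R)))))
  (add (call weightᶠ (cons halved (leftOfCoin R))) (call weightᶠ (cons halved (rightOfCoin R))))
  where
  R      = snd arg
  halved = cons (fst (fst arg)) (half (snd (fst arg)))

-- Argument (o , o′).  A candidate is a pair of a score and an index; the index is irrelevant if the
-- score is 0.
betterCode : Code 1
betterCode = ifzero monus (fst (snd arg)) (fst (fst arg)) then fst arg else snd arg

-- Argument ((w , R) , T).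
bestCode : Code 1
bestCode = caseTree T (cons (lit 0) (lit 0))
  (call betterᶠ (cons
    (cons (call weightᶠ (cons (cons (index T) (fst (fst arg))) (snd (fst arg)))) (index T))
    (call betterᶠ (cons (call bestᶠ (cons (fst arg) (leftOfQuery T)))
                        (call bestᶠ (cons (fst arg) (rightOfQuery T)))))))
  (call betterᶠ (cons (call bestᶠ (cons (fst arg) (leftOfCoin T)))
                      (call bestᶠ (cons (fst arg) (rightOfCoin T)))))
  where T = snd arg

-- Argument (a , b).  The product a b is twice a ⌊ b /2⌋, plus a if b is odd.
productCode : Code 1
productCode = ifzero snd arg then lit 0 else
  let′ (call productᶠ (cons (fst arg) (half (snd arg))))
    (ifzero monus (snd (var 1F)) (add (half (snd (var 1F))) (half (snd (var 1F))))
     then add (var 0F) (var 0F)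
     else add (add (var 0F) (var 0F)) (fst (var 1F)))

-- The average of two fractions, each a pair of a numerator and a denominator.
averageCode : Code 1
averageCode = cons
  (add (call productᶠ (cons (fst (fst arg)) (snd (snd arg))))
       (call productᶠ (cons (fst (snd arg)) (snd (fst arg)))))
  (let′ (call productᶠ (cons (snd (fst arg)) (snd (snd arg)))) (add (var 0F) (var 0F)))

-- Argument R.
meanCode : Code 1
meanCode = caseTree arg (snd arg)
  (call averageᶠ (cons (call meanᶠ (leftOfQuery arg)) (call meanᶠ (rightOfQuery arg))))
  (call averageᶠ (cons (call meanᶠ (leftOfCoin arg)) (call meanᶠ (rightOfCoin arg))))

-- Argument ((budget , price) , R), where every round costs the price.
roundsCode : Code 1
roundsCode = ifzero fst (fst arg) then call meanᶠ (snd arg) else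
  let′ (call bestᶠ (cons (cons (call scaleᶠ (cons (lit 1) (snd arg))) (snd arg)) (snd arg)))
    (ifzero fst (var 0F) then call meanᶠ (snd (var 1F)) else
     call roundsᶠ (cons
       (cons (monus (fst (fst (var 1F))) (snd (fst (var 1F)))) (snd (fst (var 1F))))
       (call restrictᶠ (cons (cons (snd (var 0F)) (query (snd (var 0F)))) (snd (var 1F))))))

-- Argument (R , ε).
mainCode : Code 1
mainCode = let′ (call complexityᶠ (fst arg))
  (call roundsᶠ (cons
    (cons (call productᶠ (cons (snd (snd (var 1F))) (call productᶠ (cons (var 0F) (var 0F)))))
          (fst (snd (var 1F))))
    (call simplifyᶠ (fst (var 1F)))))

online : Program
online = record { extra = 11 ; body =
  mainCode ∷ restrictCode ∷ simplifyCode ∷ complexityCode ∷ scaleCode ∷ weightCode ∷ betterCode ∷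
  bestCode ∷ productCode ∷ meanCode ∷ averageCode ∷ roundsCode ∷ [] }

------------------------------------------------------------------------
-- Sizes of trees, and their means as fractions

-- The size of a tree in which internal nodes count one and leaves according to their label.
measure : ∀ {n} → (ℚ → ℕ) → RDT n → ℕ
measure f (leaf v _ _)     = f v
measure f (decision _ l r) = suc (measure f l ℕ.+ measure f r)
measure f (stochastic l r) = suc (measure f l ℕ.+ measure f r)

nodes bits : ∀ {n} → RDT n → ℕ
nodes = measure (λ _ → 1)
-- A bound on the length of the denominator of the mean.
bits  = measure (λ v → suc ⌊log₂ ↧ₙ v ⌋)

measure-restrict : ∀ {n} f i b (R : RDT n) → measure f (restrict i b R) ℕ.≤ measure f R
measure-restrict f i b (leaf v p q) = ℕ.≤-refl
measure-restrict f i b (decision j l r) with i Fin.≟ j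
measure-restrict f i true  (decision j l r) | yes _ =
  ℕ.m≤n⇒m≤1+n (ℕ.≤-trans (measure-restrict f i true r) (ℕ.m≤n+m _ (measure f l)))
measure-restrict f i false (decision j l r) | yes _ =
  ℕ.m≤n⇒m≤1+n (ℕ.≤-trans (measure-restrict f i false l) (ℕ.m≤m+n _ (measure f r)))
measure-restrict f i b (decision j l r) | no _ =
  s≤s (ℕ.+-mono-≤ (measure-restrict f i b l) (measure-restrict f i b r))
measure-restrict f i b (stochastic l r) =
  s≤s (ℕ.+-mono-≤ (measure-restrict f i b l) (measure-restrict f i b r))

measure-simplify : ∀ {n} f (R : RDT n) → measure f (simplify R) ℕ.≤ measure f R
measure-simplify f (leaf v p q)     = ℕ.≤-refl
measure-simplify f (decision i l r) = s≤s (ℕ.+-mono-≤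
  (ℕ.≤-trans (measure-restrict f i false (simplify l)) (measure-simplify f l))
  (ℕ.≤-trans (measure-restrict f i true (simplify r)) (measure-simplify f r)))
measure-simplify f (stochastic l r) = s≤s (ℕ.+-mono-≤ (measure-simplify f l) (measure-simplify f r))

-- A queried variable disappears, together with at least one node; this bounds the number of rounds.
nodes-restrict : ∀ {n} i b w (R : RDT n) → weight i w R ≢ 0 → nodes (restrict i b R) ℕ.< nodes R
nodes-restrict-children : ∀ {n} i b w (l r : RDT n) → weight i w l ℕ.+ weight i w r ≢ 0 →
  nodes (restrict i b l) ℕ.+ nodes (restrict i b r) ℕ.< nodes l ℕ.+ nodes r
nodes-restrict i b w (leaf _ _ _) h = ⊥-elim (h refl)
nodes-restrict i b w (decision j l r) h with i Fin.≟ j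
nodes-restrict i true  w (decision j l r) h | yes _ =
  s≤s (ℕ.≤-trans (measure-restrict _ i true r) (ℕ.m≤n+m _ (nodes l)))
nodes-restrict i false w (decision j l r) h | yes _ =
  s≤s (ℕ.≤-trans (measure-restrict _ i false l) (ℕ.m≤m+n _ (nodes r)))
nodes-restrict i b w (decision j l r) h | no _ = s≤s (nodes-restrict-children i b ⌊ w /2⌋ l r h)
nodes-restrict i b w (stochastic l r) h = s≤s (nodes-restrict-children i b ⌊ w /2⌋ l r h)
nodes-restrict-children i b w l r h with weight i w l ℕ.≟ 0
... | no  p = ℕ.+-mono-<-≤ (nodes-restrict i b w l p) (measure-restrict _ i b r)
... | yes p = ℕ.+-mono-≤-< (measure-restrict _ i b l)
                (nodes-restrict i b w r (λ q → h (cong₂ ℕ._+_ p q)))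

-- The mean as a fraction, computed without reduction to lowest terms.
numerator denominator : ∀ {n} → RDT n → ℕ
numerator (leaf v _ _)     = ℤ.∣ ↥ v ∣
numerator (decision _ l r) = numerator l ℕ.* denominator r ℕ.+ numerator r ℕ.* denominator l
numerator (stochastic l r) = numerator l ℕ.* denominator r ℕ.+ numerator r ℕ.* denominator l
denominator (leaf v _ _)     = ↧ₙ v
denominator (decision _ l r) = denominator l ℕ.* denominator r ℕ.+ denominator l ℕ.* denominator r
denominator (stochastic l r) = denominator l ℕ.* denominator r ℕ.+ denominator l ℕ.* denominator r

average-fraction : ∀ u v a b c d → u * fromℕ b ≡ fromℕ a → v * fromℕ d ≡ fromℕ c →
  ½ * (u + v) * fromℕ (b ℕ.* d ℕ.+ b ℕ.* d) ≡ fromℕ (a ℕ.* d ℕ.+ c ℕ.* b)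
average-fraction u v a b c d p q
  rewrite fromℕ-+ (b ℕ.* d) (b ℕ.* d) | fromℕ-* b d
        | fromℕ-+ (a ℕ.* d) (c ℕ.* b) | fromℕ-* a d | fromℕ-* c b | sym p | sym q =
  solve 4 (λ u v b d → con ½ :* (u :+ v) :* (b :* d :+ b :* d) := u :* b :* d :+ v :* d :* b) refl
    u v (fromℕ b) (fromℕ d)

mean-fraction : ∀ {n} (R : RDT n) → mean R * fromℕ (denominator R) ≡ fromℕ (numerator R)
mean-fraction (leaf v p _)     = nonneg-fraction v p
mean-fraction (decision _ l r) = average-fraction (mean l) (mean r)
  (numerator l) (denominator l) (numerator r) (denominator r) (mean-fraction l) (mean-fraction r)
mean-fraction (stochastic l r) = average-fraction (mean l) (mean r)
  (numerator l) (denominator l) (numerator r) (denominator r) (mean-fraction l) (mean-fraction r)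

double-nonZero : ∀ a b .{{_ : ℕ.NonZero a}} .{{_ : ℕ.NonZero b}} → ℕ.NonZero (a ℕ.* b ℕ.+ a ℕ.* b)
double-nonZero (suc a) (suc b) = _

denominator-nonZero : ∀ {n} (R : RDT n) → ℕ.NonZero (denominator R)
denominator-nonZero (leaf (mkℚ _ _ _) _ _) = _
denominator-nonZero (decision _ l r) = double-nonZero (denominator l) (denominator r)
  {{denominator-nonZero l}} {{denominator-nonZero r}}
denominator-nonZero (stochastic l r) = double-nonZero (denominator l) (denominator r)
  {{denominator-nonZero l}} {{denominator-nonZero r}}

mean-represented : ∀ {n} (R : RDT n) →
                   pair (nat (numerator R)) (nat (denominator R)) Represents mean R
mean-represented R = subst (pair (nat (numerator R)) (nat (denominator R)) Represents_)
  (sym (/-unique (numerator R) (denominator R) {{denominator-nonZero R}} (mean-fraction R)))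
  (fraction (numerator R) (denominator R) {{denominator-nonZero R}})

n<2^suc⌊log₂n⌋ : ∀ m → m ℕ.< 2 ℕ.^ suc ⌊log₂ m ⌋
n<2^suc⌊log₂n⌋ m = ℕ.≰⇒> λ p → ℕ.1+n≰n (subst (ℕ._≤ ⌊log₂ m ⌋) (⌊log₂[2^n]⌋≡n (suc ⌊log₂ m ⌋)) (⌊log₂⌋-mono-≤ p))

double-<-2^ : ∀ {a b} k m → a ℕ.< 2 ℕ.^ k → b ℕ.< 2 ℕ.^ m →
              a ℕ.* b ℕ.+ a ℕ.* b ℕ.< 2 ℕ.^ suc (k ℕ.+ m)
double-<-2^ k m p q
  rewrite ℕ.+-identityʳ (2 ℕ.^ (k ℕ.+ m)) | ℕ.^-distribˡ-+-* 2 k m = ℕ.+-mono-< (ℕ.*-mono-< p q) (ℕ.*-mono-< p q)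

denominator-< : ∀ {n} (R : RDT n) → denominator R ℕ.< 2 ℕ.^ bits R
denominator-< (leaf v _ _)     = n<2^suc⌊log₂n⌋ (↧ₙ v)
denominator-< (decision _ l r) = double-<-2^ (bits l) (bits r) (denominator-< l) (denominator-< r)
denominator-< (stochastic l r) = double-<-2^ (bits l) (bits r) (denominator-< l) (denominator-< r)

measure≤size : ∀ {n} f → (∀ v p q → f v ℕ.≤ size (encode {n} (leaf v p q))) →
               ∀ (R : RDT n) → measure f R ℕ.≤ size (encode R)
measure≤size f h (leaf v p q)     = h v p q
measure≤size f h (decision i l r) = s≤s (ℕ.m≤n⇒m≤o+n (size (nat 1)) (ℕ.m≤n⇒m≤1+n
  (ℕ.m≤n⇒m≤o+n (size (nat (toℕ i))) (ℕ.m≤n⇒m≤1+n (ℕ.+-mono-≤ (measure≤size f h l) (measure≤size f h r))))))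
measure≤size f h (stochastic l r) = s≤s (ℕ.m≤n⇒m≤o+n (size (nat 2)) (ℕ.m≤n⇒m≤1+n
  (ℕ.+-mono-≤ (measure≤size f h l) (measure≤size f h r))))

nodes≤size : ∀ {n} (R : RDT n) → nodes R ℕ.≤ size (encode R)
nodes≤size = measure≤size _ (λ v p q → s≤s z≤n)

bits≤size : ∀ {n} (R : RDT n) → bits R ℕ.≤ size (encode R)
bits≤size = measure≤size _ (λ v p q → ℕ.m≤n⇒m≤1+n (ℕ.m≤n⇒m≤o+n (size (nat 0)) (ℕ.m≤n⇒m≤1+n
  (ℕ.m≤n⇒m≤o+n (size (nat ℤ.∣ ↥ v ∣)) (ℕ.n≤1+n _)))))

queryComplexity≤nodes : ∀ {n} (R : RDT n) → queryComplexity R ℕ.≤ nodes R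
queryComplexity≤nodes (leaf v p q)     = z≤n
queryComplexity≤nodes (decision i l r) = s≤s (ℕ.≤-trans (ℕ.m⊔n≤m+n (queryComplexity l) (queryComplexity r))
  (ℕ.+-mono-≤ (queryComplexity≤nodes l) (queryComplexity≤nodes r)))
queryComplexity≤nodes (stochastic l r) = ℕ.m≤n⇒m≤1+n (ℕ.≤-trans (ℕ.m⊔n≤m+n (queryComplexity l) (queryComplexity r))
  (ℕ.+-mono-≤ (queryComplexity≤nodes l) (queryComplexity≤nodes r)))

n<2^n : ∀ m → m ℕ.< 2 ℕ.^ m
n<2^n zero    = s≤s z≤n
n<2^n (suc m) = ℕ.+-mono-≤ (ℕ.≤-trans (s≤s z≤n) (n<2^n m)) (ℕ.≤-trans (n<2^n m) (ℕ.m≤m+n _ 0))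

------------------------------------------------------------------------
-- Timed evaluation

-- The time charged for the instructions of one call, not counting nested calls.  It is abstract so
-- that the time bounds are not unfolded into sums of a hundred terms.
abstract
  K : ℕ
  K = 100

  ≤K : ∀ {c} → c ℕ.≤ 100 → c ℕ.≤ K
  ≤K h = h

module Execution {n : ℕ} (x : Vec Bool n) where
  open Semantics (Program.body online) x

  -- In environment ρ, the expression e evaluates to v with k queries, in time at most c plus the
  -- sum of ts.  Here c is a closed numeral that counts instructions, and ts lists bounds for the
  -- calls in order, so that both are computed by unification.
  record Runs {m} (ρ : Vec Value m) (e : Code m) (v : Value) (c : ℕ) (ts : List ℕ) (k : ℕ) : Set where
    constructor runs
    field
      {time}     : ℕ
      derivation : ρ ⊢ e ⇓ v [ time , k ]
      time≤      : time ℕ.≤ c ℕ.+ sum ts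

  -- On argument a, the function body f returns v with k queries in time at most T.
  Calls : Value → Code 1 → Value → ℕ → ℕ → Set
  Calls a f v T k = Runs (a ∷ []) f v 0 (T ∷ []) k

  merge : ∀ {t t′ c c′} ts {ts′} → t ℕ.≤ c ℕ.+ sum ts → t′ ℕ.≤ c′ ℕ.+ sum ts′ →
          t ℕ.+ t′ ℕ.≤ (c ℕ.+ c′) ℕ.+ sum (ts ++ ts′)
  merge {c = c} {c′} ts {ts′} p q = ℕ.≤-trans (ℕ.+-mono-≤ p q) (ℕ.≤-reflexive (trans
    (interchange c (sum ts) c′ (sum ts′)) (cong (c ℕ.+ c′ ℕ.+_) (sym (sum-++ ts ts′)))))
    where
    interchange : ∀ a b c d → a ℕ.+ b ℕ.+ (c ℕ.+ d) ≡ a ℕ.+ c ℕ.+ (b ℕ.+ d)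
    interchange = solve-∀

  -- The at most 100 instructions of a function body are rounded up to K.
  bounded : ∀ {m} {ρ : Vec Value m} {e v c ts k T} → Runs ρ e v c ts k → {_ : True (c ℕ.≤? 100)} →
            K ℕ.+ sum ts ℕ.≤ T → Runs ρ e v 0 (T ∷ []) k
  bounded {ts = ts} {T = T} (runs d p) {c≤100} q = runs d (ℕ.≤-trans p (ℕ.≤-trans
    (ℕ.+-monoˡ-≤ (sum ts) (≤K (toWitness c≤100))) (subst (_ ℕ.≤_) (sym (ℕ.+-identityʳ T)) q)))

  module _ {m} {ρ : Vec Value m} where

    -- The evaluation rules, with bounds instead of exact times.

    ↓var : ∀ {i} → Runs ρ (var i) (lookup ρ i) 1 [] 0
    ↓var = runs ⇓var ℕ.≤-refl

    ↓lit : ∀ {a} → Runs ρ (lit a) (nat a) 1 [] 0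
    ↓lit = runs ⇓lit ℕ.≤-refl

    ↓add : ∀ {e e′ a a′ c c′ ts ts′ k k′} → Runs ρ e (nat a) c ts k → Runs ρ e′ (nat a′) c′ ts′ k′ →
           Runs ρ (add e e′) (nat (a ℕ.+ a′)) (suc (c ℕ.+ c′)) (ts ++ ts′) (k ℕ.+ k′)
    ↓add {ts = ts} (runs d p) (runs d′ p′) = runs (⇓add d d′) (s≤s (merge ts p p′))

    ↓monus : ∀ {e e′ a a′ c c′ ts ts′ k k′} → Runs ρ e (nat a) c ts k → Runs ρ e′ (nat a′) c′ ts′ k′ →
             Runs ρ (monus e e′) (nat (a ℕ.∸ a′)) (suc (c ℕ.+ c′)) (ts ++ ts′) (k ℕ.+ k′)
    ↓monus {ts = ts} (runs d p) (runs d′ p′) = runs (⇓monus d d′) (s≤s (merge ts p p′))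

    ↓half : ∀ {e a c ts k} → Runs ρ e (nat a) c ts k → Runs ρ (half e) (nat ⌊ a /2⌋) (suc c) ts k
    ↓half (runs d p) = runs (⇓half d) (s≤s p)

    ↓cons : ∀ {e e′ v v′ c c′ ts ts′ k k′} → Runs ρ e v c ts k → Runs ρ e′ v′ c′ ts′ k′ →
            Runs ρ (cons e e′) (pair v v′) (suc (c ℕ.+ c′)) (ts ++ ts′) (k ℕ.+ k′)
    ↓cons {ts = ts} (runs d p) (runs d′ p′) = runs (⇓cons d d′) (s≤s (merge ts p p′))

    ↓fst : ∀ {e v v′ c ts k} → Runs ρ e (pair v v′) c ts k → Runs ρ (fst e) v (suc c) ts k
    ↓fst (runs d p) = runs (⇓fst d) (s≤s p)

    ↓snd : ∀ {e v v′ c ts k} → Runs ρ e (pair v v′) c ts k → Runs ρ (snd e) v′ (suc c) ts k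
    ↓snd (runs d p) = runs (⇓snd d) (s≤s p)

    ↓then : ∀ {e e₁ e₂ a v c c′ ts ts′ k k′} → a ≡ 0 → Runs ρ e (nat a) c ts k → Runs ρ e₁ v c′ ts′ k′ →
            Runs ρ (ifzero e then e₁ else e₂) v (suc (c ℕ.+ c′)) (ts ++ ts′) (k ℕ.+ k′)
    ↓then {ts = ts} refl (runs d p) (runs d′ p′) = runs (⇓then d d′) (s≤s (merge ts p p′))

    ↓else : ∀ {e e₁ e₂ a v c c′ ts ts′ k k′} → a ≢ 0 → Runs ρ e (nat a) c ts k → Runs ρ e₂ v c′ ts′ k′ →
            Runs ρ (ifzero e then e₁ else e₂) v (suc (c ℕ.+ c′)) (ts ++ ts′) (k ℕ.+ k′)
    ↓else {a = zero}             a≢0 _ _ = ⊥-elim (a≢0 refl)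
    ↓else {a = suc _} {ts = ts} _ (runs d p) (runs d′ p′) = runs (⇓else d d′) (s≤s (merge ts p p′))

    ↓let : ∀ {e e′ v v′ c c′ ts ts′ k k′} → Runs ρ e v c ts k → Runs (v ∷ ρ) e′ v′ c′ ts′ k′ →
           Runs ρ (let′ e e′) v′ (suc (c ℕ.+ c′)) (ts ++ ts′) (k ℕ.+ k′)
    ↓let {ts = ts} (runs d p) (runs d′ p′) = runs (⇓let d d′) (s≤s (merge ts p p′))

    ↓call : ∀ {f e v v′ c c′ ts ts′ k k′} → Runs ρ e v c ts k →
            Runs (v ∷ []) (lookup (Program.body online) f) v′ c′ ts′ k′ →
            Runs ρ (call f e) v′ (suc (c ℕ.+ c′)) (ts ++ ts′) (k ℕ.+ k′)
    ↓call {ts = ts} (runs d p) (runs d′ p′) = runs (⇓call d d′) (s≤s (merge ts p p′))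

    ↓query : ∀ {e} {i : Fin n} {c ts k} → Runs ρ e (nat (toℕ i)) c ts k →
             Runs ρ (query e) (nat (bit (lookup x i))) (suc c) ts (suc k)
    ↓query (runs d p) = runs (⇓query d) (s≤s p)

  module _ {m} {ρ : Vec Value m} where

    ↓distance : ∀ {e e′ a a′ c c′ ts ts′ k k′} → Runs ρ e (nat a) c ts k → Runs ρ e′ (nat a′) c′ ts′ k′ →
      Runs ρ (distance e e′) (nat ((a ℕ.∸ a′) ℕ.+ (a′ ℕ.∸ a)))
           (suc (suc (c ℕ.+ c′) ℕ.+ suc (c′ ℕ.+ c))) ((ts ++ ts′) ++ (ts′ ++ ts))
           ((k ℕ.+ k′) ℕ.+ (k′ ℕ.+ k))
    ↓distance r r′ = ↓add (↓monus r r′) (↓monus r′ r)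

    ↓leaf : ∀ {e e₁ e₂ e₃ w v c c′ ts ts′ k k′} → Runs ρ e (pair (nat 0) w) c ts k → Runs ρ e₁ v c′ ts′ k′ →
            Runs ρ (caseTree e e₁ e₂ e₃) v (suc (suc c ℕ.+ c′)) (ts ++ ts′) (k ℕ.+ k′)
    ↓leaf r r′ = ↓then refl (↓fst r) r′

    -- At an internal node, e is evaluated twice to find the kind of the root; requiring that it makes
    -- no calls keeps its cost in the numeral.
    ↓decision : ∀ {e e₁ e₂ e₃ w v c c′ ts′ k k′} → Runs ρ e (pair (nat 1) w) c [] k → Runs ρ e₂ v c′ ts′ k′ →
      Runs ρ (caseTree e e₁ e₂ e₃) v (suc (suc c ℕ.+ suc (suc (suc c ℕ.+ 1) ℕ.+ c′))) ts′
           (k ℕ.+ (k ℕ.+ 0 ℕ.+ k′))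
    ↓decision r r′ = ↓else (λ ()) (↓fst r) (↓then refl (↓monus (↓fst r) ↓lit) r′)

    ↓stochastic : ∀ {e e₁ e₂ e₃ w v c c′ ts′ k k′} → Runs ρ e (pair (nat 2) w) c [] k → Runs ρ e₃ v c′ ts′ k′ →
      Runs ρ (caseTree e e₁ e₂ e₃) v (suc (suc c ℕ.+ suc (suc (suc c ℕ.+ 1) ℕ.+ c′))) ts′
           (k ℕ.+ (k ℕ.+ 0 ℕ.+ k′))
    ↓stochastic r r′ = ↓else (λ ()) (↓fst r) (↓else (λ ()) (↓monus (↓fst r) ↓lit) r′)

    ↓index : ∀ {e u v w c ts k} → Runs ρ e (pair u (pair v w)) c ts k → Runs ρ (index e) v (2 ℕ.+ c) ts k
    ↓index r = ↓fst (↓snd r)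

    ↓leftOfQuery : ∀ {e t i v w c ts k} → Runs ρ e (pair t (pair i (pair v w))) c ts k →
                   Runs ρ (leftOfQuery e) v (3 ℕ.+ c) ts k
    ↓leftOfQuery r = ↓fst (↓snd (↓snd r))

    ↓rightOfQuery : ∀ {e t i v w c ts k} → Runs ρ e (pair t (pair i (pair v w))) c ts k →
                    Runs ρ (rightOfQuery e) w (3 ℕ.+ c) ts k
    ↓rightOfQuery r = ↓snd (↓snd (↓snd r))

    ↓leftOfCoin : ∀ {e t v w c ts k} → Runs ρ e (pair t (pair v w)) c ts k →
                  Runs ρ (leftOfCoin e) v (2 ℕ.+ c) ts k
    ↓leftOfCoin r = ↓fst (↓snd r)

    ↓rightOfCoin : ∀ {e t v w c ts k} → Runs ρ e (pair t (pair v w)) c ts k →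
                   Runs ρ (rightOfCoin e) w (2 ℕ.+ c) ts k
    ↓rightOfCoin r = ↓snd (↓snd r)

    ↓maximum : ∀ {e e′ a a′ c c′ ts ts′ k k′} → Runs ρ e (nat a) c ts k → Runs ρ e′ (nat a′) c′ ts′ k′ →
      Runs ρ (maximum e e′) (nat (a ℕ.+ (a′ ℕ.∸ a))) (suc (suc (c ℕ.+ c′) ℕ.+ 8)) ((ts ++ ts′) ++ [])
           (k ℕ.+ k′ ℕ.+ 0)
    ↓maximum r r′ = ↓let (↓cons r r′) (↓add (↓fst ↓var) (↓monus (↓snd ↓var) (↓fst ↓var)))

  ----------------------------------------------------------------------
  -- Restriction

  distance-≡ : ∀ a → (a ℕ.∸ a) ℕ.+ (a ℕ.∸ a) ≡ 0
  distance-≡ a rewrite ℕ.n∸n≡0 a = refl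

  distance-≢ : ∀ {i j : Fin n} → i ≢ j → (toℕ i ℕ.∸ toℕ j) ℕ.+ (toℕ j ℕ.∸ toℕ i) ≢ 0
  distance-≢ {i} {j} i≢j d≡0 = i≢j (Fin.toℕ-injective (ℕ.≤-antisym
    (ℕ.m∸n≡0⇒m≤n (ℕ.m+n≡0⇒m≡0 (toℕ i ℕ.∸ toℕ j) d≡0))
    (ℕ.m∸n≡0⇒m≤n (ℕ.m+n≡0⇒n≡0 (toℕ i ℕ.∸ toℕ j) d≡0))))

  -- Bounds for the calls made at a node with p and q nodes below it, when the bound is
  -- proportional to the number of nodes.

  leafBound : ∀ {a} → K ℕ.≤ a → K ℕ.+ 0 ℕ.≤ 1 ℕ.* a
  leafBound h = ℕ.+-monoˡ-≤ 0 h

  leftBound : ∀ p q → K ℕ.+ (p ℕ.* K ℕ.+ 0) ℕ.≤ suc (p ℕ.+ q) ℕ.* K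
  leftBound p q = ℕ.+-monoʳ-≤ K (subst (ℕ._≤ (p ℕ.+ q) ℕ.* K) (sym (ℕ.+-identityʳ (p ℕ.* K)))
    (ℕ.*-monoˡ-≤ K (ℕ.m≤m+n p q)))

  rightBound : ∀ p q → K ℕ.+ (q ℕ.* K ℕ.+ 0) ℕ.≤ suc (p ℕ.+ q) ℕ.* K
  rightBound p q = ℕ.+-monoʳ-≤ K (subst (ℕ._≤ (p ℕ.+ q) ℕ.* K) (sym (ℕ.+-identityʳ (q ℕ.* K)))
    (ℕ.*-monoˡ-≤ K (ℕ.m≤n+m q p)))

  nodeBound : ∀ p q {a} → K ℕ.≤ a → K ℕ.+ (p ℕ.* a ℕ.+ (q ℕ.* a ℕ.+ 0)) ℕ.≤ suc (p ℕ.+ q) ℕ.* a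
  nodeBound p q {a} h = ℕ.+-mono-≤ h (ℕ.≤-reflexive (rearrange p q a))
    where
    rearrange : ∀ p q a → p ℕ.* a ℕ.+ (q ℕ.* a ℕ.+ 0) ≡ (p ℕ.+ q) ℕ.* a
    rearrange = solve-∀

  left≤ : ∀ p q {M} → suc (p ℕ.+ q) ℕ.≤ M → p ℕ.≤ M
  left≤ p q h = ℕ.≤-trans (ℕ.m≤n⇒m≤1+n (ℕ.m≤m+n p q)) h

  right≤ : ∀ p q {M} → suc (p ℕ.+ q) ℕ.≤ M → q ℕ.≤ M
  right≤ p q h = ℕ.≤-trans (ℕ.m≤n⇒m≤1+n (ℕ.m≤n+m q p)) h

  restrict-runs : ∀ i b (R : RDT n) →
    Calls (pair (pair (nat (toℕ i)) (nat (bit b))) (encode R)) restrictCode (encode (restrict i b R))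
          (nodes R ℕ.* K) 0
  restrict-runs i b (leaf v p q) = bounded (↓leaf (↓snd ↓var) (↓snd ↓var)) (leafBound ℕ.≤-refl)
  restrict-runs i b (decision j l r) with i Fin.≟ j
  restrict-runs i false (decision j l r) | yes refl = bounded
    (↓decision (↓snd ↓var) (↓then (distance-≡ (toℕ i)) (↓distance (↓fst (↓fst ↓var)) (↓index (↓snd ↓var)))
      (↓then refl (↓snd (↓fst ↓var))
        (↓call (↓cons (↓fst ↓var) (↓leftOfQuery (↓snd ↓var))) (restrict-runs i false l)))))
    (leftBound (nodes l) (nodes r))
  restrict-runs i true (decision j l r) | yes refl = bounded
    (↓decision (↓snd ↓var) (↓then (distance-≡ (toℕ i)) (↓distance (↓fst (↓fst ↓var)) (↓index (↓snd ↓var)))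
      (↓else (λ ()) (↓snd (↓fst ↓var))
        (↓call (↓cons (↓fst ↓var) (↓rightOfQuery (↓snd ↓var))) (restrict-runs i true r)))))
    (rightBound (nodes l) (nodes r))
  restrict-runs i b (decision j l r) | no i≢j = bounded
    (↓decision (↓snd ↓var) (↓else (distance-≢ i≢j) (↓distance (↓fst (↓fst ↓var)) (↓index (↓snd ↓var)))
      (↓cons ↓lit (↓cons (↓index (↓snd ↓var)) (↓cons
        (↓call (↓cons (↓fst ↓var) (↓leftOfQuery (↓snd ↓var))) (restrict-runs i b l))
        (↓call (↓cons (↓fst ↓var) (↓rightOfQuery (↓snd ↓var))) (restrict-runs i b r)))))))
    (nodeBound (nodes l) (nodes r) ℕ.≤-refl)
  restrict-runs i b (stochastic l r) = bounded
    (↓stochastic (↓snd ↓var) (↓cons ↓lit (↓cons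
      (↓call (↓cons (↓fst ↓var) (↓leftOfCoin (↓snd ↓var))) (restrict-runs i b l))
      (↓call (↓cons (↓fst ↓var) (↓rightOfCoin (↓snd ↓var))) (restrict-runs i b r)))))
    (nodeBound (nodes l) (nodes r) ℕ.≤-refl)

  ----------------------------------------------------------------------
  -- Simplification, query complexity and weights

  K≤suc*K : ∀ m → K ℕ.≤ suc m ℕ.* K
  K≤suc*K m = ℕ.m≤m+n K (m ℕ.* K)

  -- At a query node, the subtrees are restricted after they are simplified.
  simplifyBound : ∀ p q s t M → s ℕ.+ t ℕ.≤ M →
    K ℕ.+ (p ℕ.* (suc M ℕ.* K) ℕ.+ (s ℕ.* K ℕ.+ (q ℕ.* (suc M ℕ.* K) ℕ.+ (t ℕ.* K ℕ.+ 0)))) ℕ.≤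
    suc (p ℕ.+ q) ℕ.* (suc M ℕ.* K)
  simplifyBound p q s t M h = subst (ℕ._≤ suc (p ℕ.+ q) ℕ.* (suc M ℕ.* K))
    (rearrange K p q s t (suc M ℕ.* K))
    (ℕ.+-monoˡ-≤ ((p ℕ.+ q) ℕ.* (suc M ℕ.* K)) (ℕ.*-monoˡ-≤ K (s≤s h)))
    where
    rearrange : ∀ c p q s t a → suc (s ℕ.+ t) ℕ.* c ℕ.+ (p ℕ.+ q) ℕ.* a ≡
                c ℕ.+ (p ℕ.* a ℕ.+ (s ℕ.* c ℕ.+ (q ℕ.* a ℕ.+ (t ℕ.* c ℕ.+ 0))))
    rearrange = solve-∀

  simplify-runs : ∀ M (R : RDT n) → nodes R ℕ.≤ M →
    Calls (encode R) simplifyCode (encode (simplify R)) (nodes R ℕ.* (suc M ℕ.* K)) 0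
  simplify-runs M (leaf v p q) h = bounded (↓leaf ↓var ↓var) (leafBound (K≤suc*K M))
  simplify-runs M (decision i l r) h = bounded
    (↓decision ↓var (↓cons ↓lit (↓cons (↓index ↓var) (↓cons
      (↓call (↓cons (↓cons (↓index ↓var) ↓lit) (↓call (↓leftOfQuery ↓var) (simplify-runs M l (left≤ (nodes l) (nodes r) h))))
             (restrict-runs i false (simplify l)))
      (↓call (↓cons (↓cons (↓index ↓var) ↓lit) (↓call (↓rightOfQuery ↓var) (simplify-runs M r (right≤ (nodes l) (nodes r) h))))
             (restrict-runs i true (simplify r)))))))
    (simplifyBound (nodes l) (nodes r) (nodes (simplify l)) (nodes (simplify r)) M
      (ℕ.≤-trans (ℕ.+-mono-≤ (measure-simplify _ l) (measure-simplify _ r)) (ℕ.≤-trans (ℕ.n≤1+n _) h)))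
  simplify-runs M (stochastic l r) h = bounded
    (↓stochastic ↓var (↓cons ↓lit (↓cons
      (↓call (↓leftOfCoin ↓var) (simplify-runs M l (left≤ (nodes l) (nodes r) h)))
      (↓call (↓rightOfCoin ↓var) (simplify-runs M r (right≤ (nodes l) (nodes r) h))))))
    (nodeBound (nodes l) (nodes r) (K≤suc*K M))

  ⊔-∸ : ∀ a b → a ℕ.+ (b ℕ.∸ a) ≡ a ℕ.⊔ b
  ⊔-∸ a b with ℕ.≤-total a b
  ... | inj₁ p = trans (ℕ.m+[n∸m]≡n p) (sym (ℕ.m≤n⇒m⊔n≡n p))
  ... | inj₂ p = trans (cong (a ℕ.+_) (ℕ.m≤n⇒m∸n≡0 p)) (trans (ℕ.+-identityʳ a) (sym (ℕ.m≥n⇒m⊔n≡m p)))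

  complexity-runs : ∀ (R : RDT n) →
    Calls (encode R) complexityCode (nat (queryComplexity R)) (nodes R ℕ.* K) 0
  complexity-runs (leaf v p q) = bounded (↓leaf ↓var ↓lit) (leafBound ℕ.≤-refl)
  complexity-runs (decision i l r)
    rewrite sym (⊔-∸ (queryComplexity l) (queryComplexity r)) = bounded
    (↓decision ↓var (↓add ↓lit (↓maximum (↓call (↓leftOfQuery ↓var) (complexity-runs l))
                                         (↓call (↓rightOfQuery ↓var) (complexity-runs r)))))
    (nodeBound (nodes l) (nodes r) ℕ.≤-refl)
  complexity-runs (stochastic l r)
    rewrite sym (⊔-∸ (queryComplexity l) (queryComplexity r)) = bounded
    (↓stochastic ↓var (↓maximum (↓call (↓leftOfCoin ↓var) (complexity-runs l))
                                (↓call (↓rightOfCoin ↓var) (complexity-runs r))))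
    (nodeBound (nodes l) (nodes r) ℕ.≤-refl)

  scale-runs : ∀ w (R : RDT n) → Calls (pair (nat w) (encode R)) scaleCode (nat (scale w R)) (nodes R ℕ.* K) 0
  scale-runs w (leaf v p q) = bounded (↓leaf (↓snd ↓var) (↓fst ↓var)) (leafBound ℕ.≤-refl)
  scale-runs w (decision i l r) = bounded
    (↓decision (↓snd ↓var) (↓call (↓cons
      (↓call (↓cons (↓add (↓fst ↓var) (↓fst ↓var)) (↓leftOfQuery (↓snd ↓var))) (scale-runs (w ℕ.+ w) l))
      (↓rightOfQuery (↓snd ↓var))) (scale-runs (scale (w ℕ.+ w) l) r)))
    (nodeBound (nodes l) (nodes r) ℕ.≤-refl)
  scale-runs w (stochastic l r) = bounded
    (↓stochastic (↓snd ↓var) (↓call (↓cons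
      (↓call (↓cons (↓add (↓fst ↓var) (↓fst ↓var)) (↓leftOfCoin (↓snd ↓var))) (scale-runs (w ℕ.+ w) l))
      (↓rightOfCoin (↓snd ↓var))) (scale-runs (scale (w ℕ.+ w) l) r)))
    (nodeBound (nodes l) (nodes r) ℕ.≤-refl)

  weight-runs : ∀ i w (R : RDT n) →
    Calls (pair (pair (nat (toℕ i)) (nat w)) (encode R)) weightCode (nat (weight i w R)) (nodes R ℕ.* K) 0
  weight-runs i w (leaf v p q) = bounded (↓leaf (↓snd ↓var) ↓lit) (leafBound ℕ.≤-refl)
  weight-runs i w (decision j l r) with i Fin.≟ j
  ... | yes refl = bounded
    (↓decision (↓snd ↓var) (↓add
      (↓then (distance-≡ (toℕ i)) (↓distance (↓fst (↓fst ↓var)) (↓index (↓snd ↓var))) (↓snd (↓fst ↓var)))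
      (↓add (↓call (↓cons (↓cons (↓fst (↓fst ↓var)) (↓half (↓snd (↓fst ↓var)))) (↓leftOfQuery (↓snd ↓var)))
                   (weight-runs i ⌊ w /2⌋ l))
            (↓call (↓cons (↓cons (↓fst (↓fst ↓var)) (↓half (↓snd (↓fst ↓var)))) (↓rightOfQuery (↓snd ↓var)))
                   (weight-runs i ⌊ w /2⌋ r)))))
    (nodeBound (nodes l) (nodes r) ℕ.≤-refl)
  ... | no i≢j = bounded
    (↓decision (↓snd ↓var) (↓add
      (↓else (distance-≢ i≢j) (↓distance (↓fst (↓fst ↓var)) (↓index (↓snd ↓var))) ↓lit)
      (↓add (↓call (↓cons (↓cons (↓fst (↓fst ↓var)) (↓half (↓snd (↓fst ↓var)))) (↓leftOfQuery (↓snd ↓var)))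
                   (weight-runs i ⌊ w /2⌋ l))
            (↓call (↓cons (↓cons (↓fst (↓fst ↓var)) (↓half (↓snd (↓fst ↓var)))) (↓rightOfQuery (↓snd ↓var)))
                   (weight-runs i ⌊ w /2⌋ r)))))
    (nodeBound (nodes l) (nodes r) ℕ.≤-refl)
  weight-runs i w (stochastic l r) = bounded
    (↓stochastic (↓snd ↓var)
      (↓add (↓call (↓cons (↓cons (↓fst (↓fst ↓var)) (↓half (↓snd (↓fst ↓var)))) (↓leftOfCoin (↓snd ↓var)))
                   (weight-runs i ⌊ w /2⌋ l))
            (↓call (↓cons (↓cons (↓fst (↓fst ↓var)) (↓half (↓snd (↓fst ↓var)))) (↓rightOfCoin (↓snd ↓var)))
                   (weight-runs i ⌊ w /2⌋ r))))
    (nodeBound (nodes l) (nodes r) ℕ.≤-refl)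

  -- Without a candidate the index is 0, which is never used.
  optionIndex : Maybe (Fin n) → ℕ
  optionIndex nothing  = 0
  optionIndex (just i) = toℕ i

  -- The representation of a candidate in the program.
  candidate : ℕ → RDT n → Maybe (Fin n) → Value
  candidate w R o = pair (nat (score w R o)) (nat (optionIndex o))

  better-runs : ∀ w (R : RDT n) o o′ →
    Calls (pair (candidate w R o) (candidate w R o′)) betterCode (candidate w R (better w R o o′)) K 0
  better-runs w R o o′ with score w R o′ ℕ.∸ score w R o in eq
  ... | zero  = bounded
    (↓then eq (↓monus (↓fst (↓snd ↓var)) (↓fst (↓fst ↓var))) (↓fst ↓var)) (ℕ.≤-reflexive (ℕ.+-identityʳ K))
  ... | suc _ = bounded
    (↓else (λ z → ℕ.0≢1+n (trans (sym z) eq)) (↓monus (↓fst (↓snd ↓var)) (↓fst (↓fst ↓var))) (↓snd ↓var))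
    (ℕ.≤-reflexive (ℕ.+-identityʳ K))

  bestBound : ∀ p q m M → m ℕ.≤ M →
    K ℕ.+ (m ℕ.* K ℕ.+ (p ℕ.* ((3 ℕ.+ M) ℕ.* K) ℕ.+ (q ℕ.* ((3 ℕ.+ M) ℕ.* K) ℕ.+ (K ℕ.+ (K ℕ.+ 0))))) ℕ.≤
    suc (p ℕ.+ q) ℕ.* ((3 ℕ.+ M) ℕ.* K)
  bestBound p q m M h = subst (ℕ._≤ suc (p ℕ.+ q) ℕ.* a) (rearrange K p q m a)
    (ℕ.+-monoˡ-≤ ((p ℕ.+ q) ℕ.* a) (ℕ.*-monoˡ-≤ K (ℕ.+-monoʳ-≤ 3 h)))
    where
    a = (3 ℕ.+ M) ℕ.* K
    rearrange : ∀ c p q m a → (3 ℕ.+ m) ℕ.* c ℕ.+ (p ℕ.+ q) ℕ.* a ≡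
                c ℕ.+ (m ℕ.* c ℕ.+ (p ℕ.* a ℕ.+ (q ℕ.* a ℕ.+ (c ℕ.+ (c ℕ.+ 0)))))
    rearrange = solve-∀

  bestBound′ : ∀ p q M →
    K ℕ.+ (p ℕ.* ((3 ℕ.+ M) ℕ.* K) ℕ.+ (q ℕ.* ((3 ℕ.+ M) ℕ.* K) ℕ.+ (K ℕ.+ 0))) ℕ.≤
    suc (p ℕ.+ q) ℕ.* ((3 ℕ.+ M) ℕ.* K)
  bestBound′ p q M = subst (ℕ._≤ suc (p ℕ.+ q) ℕ.* a) (rearrange K p q a)
    (ℕ.+-monoˡ-≤ ((p ℕ.+ q) ℕ.* a) (ℕ.*-monoˡ-≤ K (ℕ.+-mono-≤ (s≤s (s≤s (z≤n {1}))) (z≤n {M}))))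
    where
    a = (3 ℕ.+ M) ℕ.* K
    rearrange : ∀ c p q a → (2 ℕ.+ 0) ℕ.* c ℕ.+ (p ℕ.+ q) ℕ.* a ≡
                c ℕ.+ (p ℕ.* a ℕ.+ (q ℕ.* a ℕ.+ (c ℕ.+ 0)))
    rearrange = solve-∀

  best-runs : ∀ M w (R T : RDT n) → nodes R ℕ.≤ M →
    Calls (pair (pair (nat w) (encode R)) (encode T)) bestCode (candidate w R (best w R T))
          (nodes T ℕ.* ((3 ℕ.+ M) ℕ.* K)) 0
  best-runs M w R (leaf v p q) h = bounded (↓leaf (↓snd ↓var) (↓cons ↓lit ↓lit)) (leafBound (K≤suc*K (2 ℕ.+ M)))
  best-runs M w R (decision j l r) h = bounded
    (↓decision (↓snd ↓var) (↓call (↓cons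
      (↓cons (↓call (↓cons (↓cons (↓index (↓snd ↓var)) (↓fst (↓fst ↓var))) (↓snd (↓fst ↓var))) (weight-runs j w R))
             (↓index (↓snd ↓var)))
      (↓call (↓cons (↓call (↓cons (↓fst ↓var) (↓leftOfQuery (↓snd ↓var))) (best-runs M w R l h))
                    (↓call (↓cons (↓fst ↓var) (↓rightOfQuery (↓snd ↓var))) (best-runs M w R r h)))
             (better-runs w R (best w R l) (best w R r))))
      (better-runs w R (just j) (better w R (best w R l) (best w R r)))))
    (bestBound (nodes l) (nodes r) (nodes R) M h)
  best-runs M w R (stochastic l r) h = bounded
    (↓stochastic (↓snd ↓var)
      (↓call (↓cons (↓call (↓cons (↓fst ↓var) (↓leftOfCoin (↓snd ↓var))) (best-runs M w R l h))
                    (↓call (↓cons (↓fst ↓var) (↓rightOfCoin (↓snd ↓var))) (best-runs M w R r h)))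
             (better-runs w R (best w R l) (best w R r))))
    (bestBound′ (nodes l) (nodes r) M)

  ----------------------------------------------------------------------
  -- Arithmetic

  parity : ∀ m → m ≡ ⌊ m /2⌋ ℕ.+ ⌊ m /2⌋ ⊎ m ≡ suc (⌊ m /2⌋ ℕ.+ ⌊ m /2⌋)
  parity zero          = inj₁ refl
  parity (suc zero)    = inj₂ refl
  parity (suc (suc m)) with parity m
  ... | inj₁ p = inj₁ (cong suc (trans (cong suc p) (sym (ℕ.+-suc ⌊ m /2⌋ ⌊ m /2⌋))))
  ... | inj₂ p = inj₂ (cong suc (trans (cong suc p) (cong suc (sym (ℕ.+-suc ⌊ m /2⌋ ⌊ m /2⌋)))))

  half-< : ∀ {m} k → m ℕ.< 2 ℕ.^ suc k → ⌊ m /2⌋ ℕ.< 2 ℕ.^ k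
  half-< {m} k p = ℕ.≰⇒> λ q → ℕ.<⇒≱ p (ℕ.≤-trans
    (ℕ.≤-trans (ℕ.≤-reflexive (cong (2 ℕ.^ k ℕ.+_) (ℕ.+-identityʳ (2 ℕ.^ k)))) (ℕ.+-mono-≤ q q))
    (twice-half m))
    where
    twice-half : ∀ m → ⌊ m /2⌋ ℕ.+ ⌊ m /2⌋ ℕ.≤ m
    twice-half m with parity m
    ... | inj₁ p = ℕ.≤-reflexive (sym p)
    ... | inj₂ p = ℕ.≤-trans (ℕ.n≤1+n _) (ℕ.≤-reflexive (sym p))

  returns : ∀ {u f a b T k} → a ≡ b → Calls u f (nat a) T k → Calls u f (nat b) T k
  returns refl r = r

  -- The time depends only on the length k of the second factor.
  product-runs : ∀ k a b → b ℕ.< 2 ℕ.^ k →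
    Calls (pair (nat a) (nat b)) productCode (nat (a ℕ.* b)) (suc k ℕ.* K) 0
  product-runs k a zero h rewrite ℕ.*-zeroʳ a =
    bounded (↓then refl (↓snd ↓var) ↓lit) (ℕ.+-monoʳ-≤ K z≤n)
  product-runs zero a (suc b) (s≤s ())
  product-runs (suc k) a (suc b) h with parity (suc b) | product-runs k a ⌊ suc b /2⌋ (half-< k h)
  ... | inj₁ p | z = returns (sym (trans (cong (a ℕ.*_) p) (ℕ.*-distribˡ-+ a ⌊ suc b /2⌋ ⌊ suc b /2⌋))) (bounded
    (↓else (λ ()) (↓snd ↓var) (↓let (↓call (↓cons (↓fst ↓var) (↓half (↓snd ↓var))) z)
      (↓then (trans (cong (ℕ._∸ (⌊ suc b /2⌋ ℕ.+ ⌊ suc b /2⌋)) p) (ℕ.n∸n≡0 (⌊ suc b /2⌋ ℕ.+ ⌊ suc b /2⌋)))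
        (↓monus (↓snd ↓var) (↓add (↓half (↓snd ↓var)) (↓half (↓snd ↓var))))
        (↓add ↓var ↓var))))
    (ℕ.≤-reflexive (cong (K ℕ.+_) (ℕ.+-identityʳ (suc k ℕ.* K)))))
  ... | inj₂ p | z = returns (sym (trans (cong (a ℕ.*_) p) (rearrange a ⌊ suc b /2⌋))) (bounded
    (↓else (λ ()) (↓snd ↓var) (↓let (↓call (↓cons (↓fst ↓var) (↓half (↓snd ↓var))) z)
      (↓else (λ d → ℕ.1+n≢0 (trans (sym (trans (cong (ℕ._∸ (⌊ suc b /2⌋ ℕ.+ ⌊ suc b /2⌋)) p)
               (ℕ.m+n∸n≡m 1 (⌊ suc b /2⌋ ℕ.+ ⌊ suc b /2⌋)))) d))
        (↓monus (↓snd ↓var) (↓add (↓half (↓snd ↓var)) (↓half (↓snd ↓var))))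
        (↓add (↓add ↓var ↓var) (↓fst ↓var)))))
    (ℕ.≤-reflexive (cong (K ℕ.+_) (ℕ.+-identityʳ (suc k ℕ.* K)))))
    where
    rearrange : ∀ a h → a ℕ.* suc (h ℕ.+ h) ≡ a ℕ.* h ℕ.+ a ℕ.* h ℕ.+ a
    rearrange = solve-∀

  average-runs : ∀ B a b c d → b ℕ.< 2 ℕ.^ B → d ℕ.< 2 ℕ.^ B →
    Calls (pair (pair (nat a) (nat b)) (pair (nat c) (nat d))) averageCode
          (pair (nat (a ℕ.* d ℕ.+ c ℕ.* b)) (nat (b ℕ.* d ℕ.+ b ℕ.* d))) (4 ℕ.* (suc B ℕ.* K)) 0
  average-runs B a b c d b< d< = bounded
    (↓cons (↓add (↓call (↓cons (↓fst (↓fst ↓var)) (↓snd (↓snd ↓var))) (product-runs B a d d<))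
                 (↓call (↓cons (↓fst (↓snd ↓var)) (↓snd (↓fst ↓var))) (product-runs B c b b<)))
           (↓let (↓call (↓cons (↓snd (↓fst ↓var)) (↓snd (↓snd ↓var))) (product-runs B b d d<))
                 (↓add ↓var ↓var)))
    (ℕ.+-monoˡ-≤ (3 ℕ.* (suc B ℕ.* K)) (K≤suc*K B))

  meanBound : ∀ p q P → K ℕ.≤ P →
    K ℕ.+ (p ℕ.* (5 ℕ.* P) ℕ.+ (q ℕ.* (5 ℕ.* P) ℕ.+ (4 ℕ.* P ℕ.+ 0))) ℕ.≤ suc (p ℕ.+ q) ℕ.* (5 ℕ.* P)
  meanBound p q P h = subst (K ℕ.+ (p ℕ.* (5 ℕ.* P) ℕ.+ (q ℕ.* (5 ℕ.* P) ℕ.+ (4 ℕ.* P ℕ.+ 0))) ℕ.≤_)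
    (rearrange p q P) (ℕ.+-monoˡ-≤ _ h)
    where
    rearrange : ∀ p q P → P ℕ.+ (p ℕ.* (5 ℕ.* P) ℕ.+ (q ℕ.* (5 ℕ.* P) ℕ.+ (4 ℕ.* P ℕ.+ 0))) ≡
                suc (p ℕ.+ q) ℕ.* (5 ℕ.* P)
    rearrange = solve-∀

  K≤5* : ∀ B → K ℕ.≤ 5 ℕ.* (suc B ℕ.* K)
  K≤5* B = ℕ.≤-trans (K≤suc*K B) (ℕ.m≤m+n (suc B ℕ.* K) _)

  mean-runs : ∀ B (R : RDT n) → bits R ℕ.≤ B →
    Calls (encode R) meanCode (pair (nat (numerator R)) (nat (denominator R)))
          (nodes R ℕ.* (5 ℕ.* (suc B ℕ.* K))) 0
  mean-runs-children : ∀ B (l r : RDT n) → suc (bits l ℕ.+ bits r) ℕ.≤ B → (bits l ℕ.≤ B × bits r ℕ.≤ B) ×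
    Calls (pair (pair (nat (numerator l)) (nat (denominator l))) (pair (nat (numerator r)) (nat (denominator r))))
      averageCode (pair (nat (numerator (stochastic l r))) (nat (denominator (stochastic l r)))) (4 ℕ.* (suc B ℕ.* K)) 0
  mean-runs B (leaf v p q) h = bounded (↓leaf ↓var (↓snd ↓var)) (leafBound (K≤5* B))
  mean-runs B (decision i l r) h with mean-runs-children B l r h
  ... | (hl , hr) , avg = bounded
    (↓decision ↓var (↓call (↓cons (↓call (↓leftOfQuery ↓var) (mean-runs B l hl))
                                  (↓call (↓rightOfQuery ↓var) (mean-runs B r hr))) avg))
    (meanBound (nodes l) (nodes r) (suc B ℕ.* K) (K≤suc*K B))
  mean-runs B (stochastic l r) h with mean-runs-children B l r h
  ... | (hl , hr) , avg = bounded
    (↓stochastic ↓var (↓call (↓cons (↓call (↓leftOfCoin ↓var) (mean-runs B l hl))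
                                    (↓call (↓rightOfCoin ↓var) (mean-runs B r hr))) avg))
    (meanBound (nodes l) (nodes r) (suc B ℕ.* K) (K≤suc*K B))
  mean-runs-children B l r h = (hl , hr) ,
    average-runs B (numerator l) (denominator l) (numerator r) (denominator r)
      (ℕ.<-≤-trans (denominator-< l) (ℕ.^-monoʳ-≤ 2 hl)) (ℕ.<-≤-trans (denominator-< r) (ℕ.^-monoʳ-≤ 2 hr))
    where
    hl : bits l ℕ.≤ B
    hl = left≤ (bits l) (bits r) h
    hr : bits r ℕ.≤ B
    hr = right≤ (bits l) (bits r) h

  ----------------------------------------------------------------------
  -- Rounds

  -- The time of one round and of the final evaluation of the mean, for trees with at most M nodes
  -- and a mean whose denominator has at most B bits.
  roundTime finalTime : ℕ → ℕ → ℕ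
  roundTime M B = K ℕ.+ M ℕ.* ((5 ℕ.+ M) ℕ.* K)
  finalTime M B = M ℕ.* (5 ℕ.* (suc B ℕ.* K))

  -- Every round but the last removes a node.
  roundsTime : ℕ → ℕ → RDT n → ℕ
  roundsTime M B R = nodes R ℕ.* roundTime M B ℕ.+ (roundTime M B ℕ.+ finalTime M B)

  doneBound : ∀ {m} M B R → m ℕ.≤ M → K ℕ.+ (m ℕ.* (5 ℕ.* (suc B ℕ.* K)) ℕ.+ 0) ℕ.≤ roundsTime M B R
  doneBound {m} M B R h = ℕ.≤-trans
    (ℕ.+-mono-≤ (ℕ.m≤m+n K (M ℕ.* ((5 ℕ.+ M) ℕ.* K)))
      (ℕ.≤-trans (ℕ.≤-reflexive (ℕ.+-identityʳ _)) (ℕ.*-monoˡ-≤ (5 ℕ.* (suc B ℕ.* K)) h)))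
    (ℕ.m≤n+m (roundTime M B ℕ.+ finalTime M B) (nodes R ℕ.* roundTime M B))

  stepBound : ∀ {m} M B → m ℕ.≤ M → K ℕ.+ (m ℕ.* K ℕ.+ (m ℕ.* ((3 ℕ.+ M) ℕ.* K) ℕ.+ m ℕ.* K)) ℕ.≤ roundTime M B
  stepBound {m} M B h = ℕ.+-monoʳ-≤ K (ℕ.≤-trans (ℕ.≤-reflexive (rearrange m M K))
    (ℕ.*-monoˡ-≤ ((5 ℕ.+ M) ℕ.* K) h))
    where
    rearrange : ∀ m M c → m ℕ.* c ℕ.+ (m ℕ.* ((3 ℕ.+ M) ℕ.* c) ℕ.+ m ℕ.* c) ≡ m ℕ.* ((5 ℕ.+ M) ℕ.* c)
    rearrange = solve-∀

  stopBound : ∀ {m} M B R → m ℕ.≤ M →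
    K ℕ.+ (m ℕ.* K ℕ.+ (m ℕ.* ((3 ℕ.+ M) ℕ.* K) ℕ.+ (m ℕ.* (5 ℕ.* (suc B ℕ.* K)) ℕ.+ 0))) ℕ.≤ roundsTime M B R
  stopBound {m} M B R h = ℕ.≤-trans
    (subst (ℕ._≤ roundTime M B ℕ.+ finalTime M B)
      (rearrange K (m ℕ.* K) (m ℕ.* ((3 ℕ.+ M) ℕ.* K)) (m ℕ.* (5 ℕ.* (suc B ℕ.* K))))
      (ℕ.+-mono-≤ (ℕ.≤-trans (ℕ.+-monoʳ-≤ K (ℕ.+-monoʳ-≤ (m ℕ.* K) (ℕ.m≤m+n _ (m ℕ.* K)))) (stepBound M B h))
                  (ℕ.*-monoˡ-≤ (5 ℕ.* (suc B ℕ.* K)) h)))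
    (ℕ.m≤n+m (roundTime M B ℕ.+ finalTime M B) (nodes R ℕ.* roundTime M B))
    where
    rearrange : ∀ a b c d → (a ℕ.+ (b ℕ.+ c)) ℕ.+ d ≡ a ℕ.+ (b ℕ.+ (c ℕ.+ (d ℕ.+ 0)))
    rearrange = solve-∀

  askBound : ∀ M B R R′ → nodes R ℕ.≤ M → nodes R′ ℕ.< nodes R →
    K ℕ.+ (nodes R ℕ.* K ℕ.+ (nodes R ℕ.* ((3 ℕ.+ M) ℕ.* K) ℕ.+
      (nodes R ℕ.* K ℕ.+ (roundsTime M B R′ ℕ.+ 0)))) ℕ.≤ roundsTime M B R
  askBound M B R R′ h h′ = subst (ℕ._≤ roundsTime M B R)
    (rearrange K (nodes R ℕ.* K) (nodes R ℕ.* ((3 ℕ.+ M) ℕ.* K)) (nodes R ℕ.* K) (roundsTime M B R′))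
    (ℕ.≤-trans (ℕ.+-monoˡ-≤ (roundsTime M B R′) (stepBound M B h))
    (ℕ.≤-trans (ℕ.≤-reflexive (sym (ℕ.+-assoc (roundTime M B) (nodes R′ ℕ.* roundTime M B) (roundTime M B ℕ.+ finalTime M B))))
    (ℕ.+-monoˡ-≤ (roundTime M B ℕ.+ finalTime M B) (ℕ.*-monoˡ-≤ (roundTime M B) h′))))
    where
    rearrange : ∀ a b c d e → (a ℕ.+ (b ℕ.+ (c ℕ.+ d))) ℕ.+ e ≡ a ℕ.+ (b ℕ.+ (c ℕ.+ (d ℕ.+ (e ℕ.+ 0))))
    rearrange = solve-∀

  rounds-runs : ∀ M B {a β D} → Rounds a β D → (R : RDT n) → nodes R ℕ.≤ M → bits R ℕ.≤ B →
    ∃[ w ] ∃[ k ] w Represents answer D R x × k ℕ.≤ D ×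
      Calls (pair (pair (nat β) (nat a)) (encode R)) roundsCode w (roundsTime M B R) k
  rounds-runs M B done R hM hB = _ , _ , mean-represented R , z≤n ,
    bounded (↓then refl (↓fst (↓fst ↓var)) (↓call (↓snd ↓var) (mean-runs B R hB))) (doneBound M B R hM)
  rounds-runs M B {D = suc D} (more r) R hM hB with round R
  ... | stop chosen z = _ , _ ,
    subst (_ Represents_) (sym (answer-stop D R x chosen)) (mean-represented R) , z≤n ,
    bounded (↓else (λ ()) (↓fst (↓fst ↓var))
      (↓let (↓call (↓cons (↓cons (↓call (↓cons ↓lit (↓snd ↓var)) (scale-runs 1 R)) (↓snd ↓var)) (↓snd ↓var))
                   (best-runs M (scale 1 R) R R hM))
            (↓then z (↓fst ↓var) (↓call (↓snd ↓var) (mean-runs B R hB)))))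
      (stopBound M B R hM)
  ... | ask i chosen eq nz
    with rounds-runs M B r (restrict i (lookup x i) R)
           (ℕ.≤-trans (measure-restrict _ i (lookup x i) R) hM) (ℕ.≤-trans (measure-restrict _ i (lookup x i) R) hB)
  ... | w , k , rep , k≤D , rest = w , suc k ,
    subst (w Represents_) (sym (answer-ask D R x chosen)) rep , s≤s k≤D ,
    bounded (↓else (λ ()) (↓fst (↓fst ↓var))
      (↓let (↓call (↓cons (↓cons (↓call (↓cons ↓lit (↓snd ↓var)) (scale-runs 1 R)) (↓snd ↓var)) (↓snd ↓var))
                   (subst (λ o → Calls (pair (pair (nat (scale 1 R)) (encode R)) (encode R)) bestCode
                                 (candidate (scale 1 R) R o) (nodes R ℕ.* ((3 ℕ.+ M) ℕ.* K)) 0) eq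
                     (best-runs M (scale 1 R) R R hM)))
            (↓else nz (↓fst ↓var) (↓call
              (↓cons (↓cons (↓monus (↓fst (↓fst ↓var)) (↓snd (↓fst ↓var))) (↓snd (↓fst ↓var)))
                     (↓call (↓cons (↓cons (↓snd ↓var) (↓query (↓snd ↓var))) (↓snd ↓var))
                            (restrict-runs i (lookup x i) R)))
              rest))))
      (askBound M B R (restrict i (lookup x i) R) hM (nodes-restrict i (lookup x i) (scale 1 R) R nz))

  -- The time of the main function on a description of length suc m, with p nodes.  The constant 33
  -- is the value of the polynomial at m = 0; expand displays the slack in its other coefficients.
  mainBound : ∀ m p → p ℕ.≤ suc m → ∀ R → nodes R ℕ.≤ suc m →
    K ℕ.+ (p ℕ.* K ℕ.+ (suc (suc m) ℕ.* K ℕ.+ (suc (suc m ℕ.+ suc m) ℕ.* K ℕ.+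
      (p ℕ.* (suc (suc m) ℕ.* K) ℕ.+ (roundsTime (suc m) (suc m) R ℕ.+ 0))))) ℕ.≤
    33 ℕ.* K ℕ.* (suc m ℕ.* (suc m ℕ.* suc m))
  mainBound m p hp R hR = ℕ.≤-trans
    (ℕ.+-monoʳ-≤ K (ℕ.+-mono-≤ (ℕ.*-monoˡ-≤ K hp) (ℕ.+-monoʳ-≤ (suc (suc m) ℕ.* K)
      (ℕ.+-monoʳ-≤ (suc (suc m ℕ.+ suc m) ℕ.* K) (ℕ.+-mono-≤ (ℕ.*-monoˡ-≤ (suc (suc m) ℕ.* K) hp)
        (ℕ.+-monoˡ-≤ 0 (ℕ.+-monoˡ-≤ (roundTime (suc m) (suc m) ℕ.+ finalTime (suc m) (suc m))
          (ℕ.*-monoˡ-≤ (roundTime (suc m) (suc m)) hR))))))))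
    (ℕ.m+n≤o⇒m≤o _ (ℕ.≤-reflexive (expand m K)))
    where
    expand : ∀ m c →
      c ℕ.+ (suc m ℕ.* c ℕ.+ (suc (suc m) ℕ.* c ℕ.+ (suc (suc m ℕ.+ suc m) ℕ.* c ℕ.+
        (suc m ℕ.* (suc (suc m) ℕ.* c) ℕ.+ (suc m ℕ.* (c ℕ.+ suc m ℕ.* ((5 ℕ.+ suc m) ℕ.* c)) ℕ.+
          ((c ℕ.+ suc m ℕ.* ((5 ℕ.+ suc m) ℕ.* c)) ℕ.+ suc m ℕ.* (5 ℕ.* (suc (suc m) ℕ.* c))) ℕ.+ 0)))))
      ℕ.+ (56 ℕ.* (m ℕ.* c) ℕ.+ 84 ℕ.* (m ℕ.* m ℕ.* c) ℕ.+ 32 ℕ.* (m ℕ.* m ℕ.* m ℕ.* c))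
      ≡ 33 ℕ.* c ℕ.* (suc m ℕ.* (suc m ℕ.* suc m))
    expand = solve-∀

  startBound : ∀ a b → 1 ℕ.≤ b → 2 ℕ.+ a ℕ.* b ℕ.≤ (2 ℕ.+ a) ℕ.* b
  startBound a b h = ℕ.≤-trans (ℕ.+-monoˡ-≤ (a ℕ.* b) (ℕ.*-monoʳ-≤ 2 h))
                               (ℕ.≤-reflexive (sym (ℕ.*-distribʳ-+ b 2 a)))

  main-runs : ∀ (R : RDT n) (ε : ℚ) {D} →
    Rounds ℤ.∣ ↥ ε ∣ (↧ₙ ε ℕ.* (queryComplexity R ℕ.* queryComplexity R)) D →
    ∃[ w ] ∃[ t ] ∃[ k ]
      ( online on pair (encode R) (encodeℚ ε) , x halts-with w [ t , k ]
      × w Represents answer D (simplify R) x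
      × t ℕ.≤ (2 ℕ.+ 33 ℕ.* K) ℕ.* (descriptionLength R ℕ.* (descriptionLength R ℕ.* descriptionLength R))
      × k ℕ.≤ D )
  main-runs R ε {D} r with size (encode R) in eq
    | nodes≤size R | bits≤size R
  ... | zero  | h | _ = ⊥-elim (size≢0 (encode R) eq)
    where
    size≢0 : ∀ v → size v ≢ 0
    size≢0 (nat _)    ()
    size≢0 (pair _ _) ()
  ... | suc m | hM | hB
    with rounds-runs (suc m) (suc m) r (simplify R)
           (ℕ.≤-trans (measure-simplify _ R) hM) (ℕ.≤-trans (measure-simplify _ R) hB)
  ... | w , k , rep , k≤D , rest = w , _ , k , halts (Runs.derivation execution) , rep ,
    ℕ.≤-trans (Runs.time≤ execution)
      (ℕ.≤-trans (ℕ.≤-reflexive (cong (2 ℕ.+_) (ℕ.+-identityʳ _)))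
                 (startBound (33 ℕ.* K) (suc m ℕ.* (suc m ℕ.* suc m)) (s≤s z≤n))) ,
    k≤D
    where
    q = queryComplexity R
    q<2^ : q ℕ.< 2 ℕ.^ suc m
    q<2^ = ℕ.≤-<-trans (ℕ.≤-trans (queryComplexity≤nodes R) hM) (n<2^n (suc m))
    q*q<2^ : q ℕ.* q ℕ.< 2 ℕ.^ (suc m ℕ.+ suc m)
    q*q<2^ = subst (q ℕ.* q ℕ.<_) (sym (ℕ.^-distribˡ-+-* 2 (suc m) (suc m))) (ℕ.*-mono-< q<2^ q<2^)
    main : Calls (pair (encode R) (encodeℚ ε)) mainCode w (33 ℕ.* K ℕ.* (suc m ℕ.* (suc m ℕ.* suc m))) k
    main = bounded
      (↓let (↓call (↓fst ↓var) (complexity-runs R))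
        (↓call (↓cons
          (↓cons (↓call (↓cons (↓snd (↓snd ↓var)) (↓call (↓cons ↓var ↓var) (product-runs (suc m) q q q<2^)))
                        (product-runs (suc m ℕ.+ suc m) (↧ₙ ε) (q ℕ.* q) q*q<2^))
                 (↓fst (↓snd ↓var)))
          (↓call (↓fst ↓var) (simplify-runs (suc m) R hM)))
          rest))
      (mainBound m (nodes R) hM (simplify R) (ℕ.≤-trans (measure-simplify _ R) hM))
    execution : Runs (pair (encode R) (encodeℚ ε) ∷ []) (call 0F (var 0F)) w 2 _ k
    execution = ↓call ↓var main

theorem4 : Σ[ A ∈ Program ] ∃[ c ] ∃[ d ] ∃[ C ]
    (∀ {n : ℕ} (q : ℕ) (R : RDT n) → queryComplexity R ℕ.≤ q →
    (ε : ℚ) (ε>0 : 0ℚ < ε) → ε < ½ →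
    let ε⁻¹ = (1/ ε) {{pos⇒nonZero ε {{positive ε>0}}}}
        N = descriptionLength R in
    Σ[ out ∈ (Vec Bool n → ℚ) ]
    (∀ (x : Vec Bool n) →
    ∃[ w ] ∃[ t ] ∃[ k ]
    ( A on pair (encode R) (encodeℚ ε) , x halts-with w [ t , k ]
    × w Represents out x
    × fromℕ t ≤ fromℕ c * (fromℕ N + fromℕ q + ε⁻¹) ^ d
    × fromℕ k ≤ fromℕ C * (fromℕ q ^ 2 * ε⁻¹ ^ 3)
    × 0ℚ ≤ out x
    × out x ≤ 1ℚ ))
    × 𝔼 (λ x → (out x - 𝔼 (λ (r : Vec Bool (randomness R)) → run R ≤-refl x r)) ^ 2) ≤ ε)
theorem4 = online , 2 ℕ.+ 33 ℕ.* K , 3 , 2 , λ q R h ε ε>0 ε<½ →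
  let e = (1/ ε) {{pos⇒nonZero ε {{positive ε>0}}}}
      inverse = ℚ.*-inverseʳ ε {{pos⇒nonZero ε {{positive ε>0}}}}
      e≥0 = ℚ.<⇒≤ (ℚ.positive⁻¹ e {{ℚ.1/pos⇒pos ε {{positive ε>0}}}})
      D , r = rounds-exist ℤ.∣ ↥ ε ∣ {{numerator-nonZero ε ε>0}}
                (↧ₙ ε ℕ.* (queryComplexity R ℕ.* queryComplexity R))
      ε≤1 = ℚ.≤-trans (ℚ.<⇒≤ ε<½) (≤-diff ½ 0≤½ refl)
  in answer D (simplify R) ,
     (λ x → let w , t , k , halting , rep , t≤ , k≤D = Execution.main-runs x R ε r in
        w , t , k , halting , rep ,
        time-≤ t (2 ℕ.+ 33 ℕ.* K) (descriptionLength R) q e e≥0 t≤ ,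
        ℚ.≤-trans (fromℕ-mono k≤D) (queries-≤ ε ε>0 ε≤1 e inverse (queryComplexity R) q h r) ,
        proj₁ (answer-bounds D (simplify R) x) , proj₂ (answer-bounds D (simplify R) x)) ,
     subst (_≤ ε) (𝔼-cong (λ x → cong (λ v → (answer D (simplify R) x - v) ^ 2)
         (trans (val-simplify R x) (sym (𝔼-run R ≤-refl x)))))
       (answer-error R ε ε>0 r)
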